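{- The exact-Steiner phase algorithm (defined in the context) is $12$-competitive for visible elective online service on every finite metric space: for every finite metric space $(X,d)$, initial position $s_0\in X$ and finite input $I$, $\operatorname{ALG}(I)\le 12\operatorname{OPT}(I)$, where $\operatorname{OPT}(I)$ is the elective offline optimum.
   Context: Model. $(X,d)$ is a finite metric space and $s_0\in X$ is the initial server position. An input $I$ is a finite set of request occurrences; each request $q$ has an arrival time $a(q)\ge 0$ and a location $x(q)\in X$. An arrival epoch is the set of all requests sharing one arrival time. A walk $P=(v_0,\ldots,v_\ell)$ in $X$ ($\ell\ge 0$) is executed instantaneously at one time, visits its listed vertices, and has length $\operatorname{len}(P)=\sum_i d(v_{i-1},v_i)$. A schedule is a finite sequence of atomic actions with nondecreasing timestamps. At time $t$ the complete epoch arriving at $t$ is processed first; then one action at $t$ performs a finite ordered sequence of walks, and no further arrival is processed until the action ends. The first walk starts at $s_0$ and every later one starts where its predecessor ended. A walk $P$ at time $t$ during which a nonempty set $B$ of pending requests is served is one service event of cost $\operatorname{len}(P)+\max_{q\in B}(t-a(q))$; a walk serving no request costs $\operatorname{len}(P)$. The cost of a schedule is the sum of these costs; every request must eventually be served. Elective service: a pending request may be included in $B$ only if its location is visited by $P$, but locations may be visited without serving. $\operatorname{OPT}(I)$ is the infimum of the cost over feasible clairvoyant elective schedules. Visible: the location of a request is revealed at its arrival. Ambient Steiner cost. For $A\subseteq X$, $\operatorname{ST}_X(A)$ is the minimum of $\sum_{\{u,v\}\in E(F)}d(u,v)$ over trees $F$ in the complete graph on $X$ with $A\subseteq V(F)$.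 Exact-Steiner phase algorithm. It uses an oracle for exact ambient Steiner trees. Maintain an anchor $s$ (initially $s_0$), where the server is parked while waiting. Every request arriving at the anchor is served immediately at zero cost and discarded. A phase starts with the first complete epoch containing a request not located at $s$; its set $P$ consists of the requests of that epoch not at $s$, together with all later arrivals not at $s$ until the phase ends. Let $\alpha=\min_{q\in P}a(q)$ and, at time $t$, $S(t)=\operatorname{ST}_X\bigl(\{s\}\cup\{x(q):q\in P\text{ has arrived by }t\}\bigr)$. At the first time $t$ (tested after processing the complete epoch at $t$) with $t-\alpha\ge S(t)$, let $F$ be a (canonically chosen) tree attaining $S(t)$ and choose a request $p\in P$ whose location is farthest from $s$ in the tree $F$. Traverse $F$ by an open depth-first walk from $s$ to $x(p)$, using each edge of the tree path from $s$ to $x(p)$ once and every other edge of $F$ twice, and serve all of $P$ in this one service event. Then set $s\leftarrow x(p)$ and end the phase. -}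

module Defs where

open import Level using (Level; _⊔_; suc; 0ℓ)
open import Algebra.Bundles using (CommutativeRing)
import Algebra.Construct.NaturalChoice.Max as Max
import Algebra.Definitions.RawMonoid as RawMonoidDefs
open import Data.Bool.Base using (if_then_else_)
open import Data.Fin.Base using (Fin)
import Data.Fin.Properties as Fin
open import Data.List.Base
  using (List; []; _∷_; _++_; map; concatMap; filter; foldr; deduplicate; allFin; tabulate)
import Data.List.Extrema as Extrema
open import Data.List.Membership.Propositional using (_∈_; _∉_)
import Data.List.Membership.DecPropositional as DecMembership
open import Data.List.NonEmpty.Base
  using (List⁺; _∷_; _⁺++_; head; last; toList)
open import Data.List.Relation.Binary.Subset.Propositional using (_⊆_)
open import Data.List.Relation.Unary.All using (All)
open import Data.List.Relation.Unary.Linked using (Linked)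
open import Data.List.Relation.Unary.Unique.Propositional using (Unique)
import Data.List.Sort as Sort
open import Data.Nat.Base using (ℕ)
open import Data.Product.Base using (∃; _×_; _,_)
open import Function.Base using (_on_)
open import Function.Bundles using (_↔_; Inverse; Injection)
open import Function.Metric.Structures using (IsGeneralMetric)
open import Function.Properties.Inverse using (Inverse⇒Injection)
open import Relation.Binary.Bundles using (DecTotalOrder)
open import Relation.Binary.Core using (Rel)
open import Relation.Binary.Definitions using (DecidableEquality)
open import Relation.Binary.PropositionalEquality.Core using (_≡_)
open import Relation.Binary.Structures using (IsDecTotalOrder)
open import Relation.Nullary.Decidable using (does; ¬?; via-injection)
open import Relation.Nullary.Negation using (¬_)

-- The library has no real numbers: distances and times take values in an
-- arbitrary ordered field, of which ℝ (classically) and ℚ are instances.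
-- Neither completeness nor the Archimedean property is assumed.

record OrderedField (c ℓ₁ ℓ₂ : Level) : Set (suc (c ⊔ ℓ₁ ⊔ ℓ₂)) where
  infix 4 _≤_
  field
    commutativeRing : CommutativeRing c ℓ₁
  open CommutativeRing commutativeRing public
  field
    _≤_             : Rel Carrier ℓ₂
    isDecTotalOrder : IsDecTotalOrder _≈_ _≤_
    +-monoʳ-≤       : ∀ x {y z} → y ≤ z → x + y ≤ x + z
    *-nonNegative   : ∀ {x y} → 0# ≤ x → 0# ≤ y → 0# ≤ x * y
    0≉1             : ¬ (0# ≈ 1#)
    inverse         : ∀ x → ¬ (x ≈ 0#) → ∃ λ y → x * y ≈ 1#

  decTotalOrder : DecTotalOrder c ℓ₁ ℓ₂
  decTotalOrder = record { isDecTotalOrder = isDecTotalOrder }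

  open DecTotalOrder decTotalOrder public using (totalOrder; _≤?_; _≟_)

  -- Multiplication by a natural number, i.e. iterated addition.
  open RawMonoidDefs +-rawMonoid public using () renaming (_×_ to _·_)

record FiniteMetricSpace {c ℓ₁ ℓ₂} (K : OrderedField c ℓ₁ ℓ₂)
       : Set (suc 0ℓ ⊔ c ⊔ ℓ₁ ⊔ ℓ₂) where
  private module K = OrderedField K
  field
    Point    : Set
    size     : ℕ
    finite   : Point ↔ Fin size
    d        : Point → Point → K.Carrier
    isMetric : IsGeneralMetric _≡_ K._≈_ K._≤_ K.0# K._+_ d

  infix 4 _≟ᵖ_
  _≟ᵖ_ : DecidableEquality Point
  _≟ᵖ_ = via-injection (Inverse⇒Injection finite) Fin._≟_

module Online {c ℓ₁ ℓ₂} (K : OrderedField c ℓ₁ ℓ₂) (M : FiniteMetricSpace K) where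

  open OrderedField K
  open FiniteMetricSpace M
  open DecMembership _≟ᵖ_ using (_∈?_)
  open Max totalOrder using () renaming (_⊔_ to _⊔ᴷ_)
  open Extrema totalOrder using (max)

  sum : List Carrier → Carrier
  sum = foldr _+_ 0#

  ------------------------------------------------------------------------
  -- Inputs, schedules and the offline optimum

  record Input : Set (c ⊔ ℓ₁ ⊔ ℓ₂) where
    field
      #requests           : ℕ
      arrival             : Fin #requests → Carrier
      location            : Fin #requests → Point
      arrival-nonNegative : ∀ q → 0# ≤ arrival q

  Walk : Set
  Walk = List⁺ Point

  pathLength : List Point → Carrier
  pathLength []           = 0#
  pathLength (x ∷ [])     = 0#
  pathLength (x ∷ y ∷ zs) = d x y + pathLength (y ∷ zs)

  len : Walk → Carrier
  len w = pathLength (toList w)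

  module _ (I : Input) where

    open Input I

    Request : Set
    Request = Fin #requests

    -- A walk together with the set of requests served during it, listed in
    -- some order; an empty list means that the walk serves nothing.
    record Service : Set where
      constructor _serving_
      field
        walk  : Walk
        batch : List Request

    record Action : Set c where
      constructor _⟫_
      field
        time     : Carrier
        services : List Service

    Schedule : Set c
    Schedule = List Action

    timedServices : Schedule → List (Carrier × Service)
    timedServices = concatMap λ (t ⟫ vs) → map (t ,_) vs

    maxDelay : Carrier → List Request → Carrier
    maxDelay t []       = 0#
    maxDelay t (q ∷ qs) = max (t - arrival q) (map (λ r → t - arrival r) qs)

    serviceCost : Carrier × Service → Carrier
    serviceCost (t , w serving B) = len w + maxDelay t B

    cost : Schedule → Carrier
    cost σ = sum (map serviceCost (timedServices σ))

    -- q has arrived by time t, has not been served yet, and is visited by w.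
    -- An epoch arriving at t precedes every action at t, hence _≤_.
    Servable : List Request → Carrier → Walk → Request → Set ℓ₂
    Servable served t w q = arrival q ≤ t × q ∉ served × location q ∈ toList w

    data Execution : Point → List Request → List (Carrier × Service) →
                     Set (c ⊔ ℓ₂) where
      finished : ∀ {s served} → (∀ q → q ∈ served) → Execution s served []
      perform  : ∀ {s served t w B vs} →
                 head w ≡ s →
                 All (Servable served t w) B →
                 Execution (last w) (B ++ served) vs →
                 Execution s served ((t , w serving B) ∷ vs)

    record Feasible (s₀ : Point) (σ : Schedule) : Set (c ⊔ ℓ₂) where
      field
        nondecreasing : Linked (_≤_ on Action.time) σ
        execution     : Execution s₀ [] (timedServices σ)

    record IsOPT (s₀ : Point) (r : Carrier) : Set (c ⊔ ℓ₂) where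
      field
        lowerBound : ∀ σ → Feasible s₀ σ → r ≤ cost σ
        greatest   : ∀ b → (∀ σ → Feasible s₀ σ → b ≤ cost σ) → b ≤ r

  ------------------------------------------------------------------------
  -- Trees in the complete graph on the points

  -- A tree is presented by choosing a root and an order on the children of
  -- each vertex; its edges join the vertices to their children.

  data Tree : Set where
    node : Point → List Tree → Tree

  root : Tree → Point
  root (node x _) = x

  vertices       : Tree → List Point
  forestVertices : List Tree → List Point
  vertices (node x cs)      = x ∷ forestVertices cs
  forestVertices []         = []
  forestVertices (T ∷ Ts)   = vertices T ++ forestVertices Ts

  -- Distinct labels: only then is the rose tree a tree of the complete graph.
  IsTree : Tree → Set
  IsTree T = Unique (vertices T)

  weight       : Tree → Carrier
  branchWeight : Point → List Tree → Carrier
  weight (node x cs)      = branchWeight x cs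
  branchWeight x []       = 0#
  branchWeight x (T ∷ Ts) = (d x (root T) + weight T) + branchWeight x Ts

  record IsSteinerTree (A : List Point) (T : Tree) : Set ℓ₂ where
    field
      isTree  : IsTree T
      spans   : A ⊆ vertices T
      minimal : ∀ T′ → IsTree T′ → A ⊆ vertices T′ → weight T ≤ weight T′

  -- Distance in the tree between its root and v; the value 0# for a point v
  -- outside the tree is irrelevant.
  treeDist   : Tree → Point → Carrier
  branchDist : Point → List Tree → Point → Carrier
  treeDist (node x cs) v    = branchDist x cs v
  branchDist x [] v         = 0#
  branchDist x (T ∷ Ts) v   =
    if does (v ∈? vertices T) then d x (root T) + treeDist T v
                              else branchDist x Ts v

  -- Closed depth-first walk; `excursions x Ts` is what follows x when the
  -- subtrees Ts hanging from x are explored in turn, returning to x each time.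
  closedWalk : Tree → List Point
  excursions : Point → List Tree → List Point
  closedWalk (node x cs)  = x ∷ excursions x cs
  excursions x []         = []
  excursions x (T ∷ Ts)   = closedWalk T ++ x ∷ excursions x Ts

  -- Open depth-first walk from the root to v: at every vertex the branch
  -- containing v is explored last and is not left again.
  openWalk     : Tree → Point → Walk
  openBranches : Point → List Tree → Point → List Point
  openWalk (node x cs) v    = x ∷ openBranches x cs v
  openBranches x [] v       = []
  openBranches x (T ∷ Ts) v =
    if does (v ∈? vertices T) then excursions x Ts ++ toList (openWalk T v)
                              else closedWalk T ++ x ∷ openBranches x Ts v

  ------------------------------------------------------------------------
  -- The exact-Steiner phase algorithm

  -- `steiner s A` is the chosen minimum tree for {s} ∪ A, presented with
  -- root s.
  record SteinerOracle : Set ℓ₂ where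
    field
      steiner : Point → List Point → Tree
      rooted  : ∀ s A → root (steiner s A) ≡ s
      optimal : ∀ s A → IsSteinerTree (s ∷ A) (steiner s A)

  -- The choice of a farthest request, with an arbitrary way of breaking ties.
  record FarthestRule (I : Input) : Set ℓ₂ where
    open Input I
    field
      choose          : Tree → List⁺ (Request I) → Request I
      choose-∈        : ∀ F P → choose F P ∈ toList P
      choose-farthest : ∀ F P {q} → q ∈ toList P →
                        treeDist F (location q) ≤ treeDist F (location (choose F P))

  module Algorithm (I : Input) (oracle : SteinerOracle) (rule : FarthestRule I) where

    open Input I
    open SteinerOracle oracle
    open FarthestRule rule
    open Sort decTotalOrder using (sort)

    epochTimes : List Carrier
    epochTimes = deduplicate _≟_ (sort (tabulate arrival))

    epoch : Carrier → List (Request I)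
    epoch t = filter (λ q → arrival q ≟ t) (allFin #requests)

    atAnchor : Point → Carrier → List (Request I)
    atAnchor s t = filter (λ q → location q ≟ᵖ s) (epoch t)

    awayFromAnchor : Point → Carrier → List (Request I)
    awayFromAnchor s t = filter (λ q → ¬? (location q ≟ᵖ s)) (epoch t)

    serveAtAnchor : Point → Carrier → Action I
    serveAtAnchor s t = t ⟫ (((s ∷ []) serving atAnchor s t) ∷ [])

    steinerTree : Point → List⁺ (Request I) → Tree
    steinerTree s P = steiner s (map location (toList P))

    nextAnchor : Point → List⁺ (Request I) → Point
    nextAnchor s P = location (choose (steinerTree s P) P)

    endPhase : Point → List⁺ (Request I) → Carrier → Action I
    endPhase s P t =
      t ⟫ ((openWalk (steinerTree s P) (nextAnchor s P) serving toList P) ∷ [])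

    -- The first τ ≥ t with S ≤ τ - α, where S is the current Steiner cost.
    trigger : Point → Carrier → List⁺ (Request I) → Carrier → Carrier
    trigger s α P t = t ⊔ᴷ (α + weight (steinerTree s P))

    -- `idle s ts`: no phase is active, the anchor is s, and the epochs at the
    -- times ts are still to come.
    -- `active s α P t ts`: a phase that started at time α (which is the least
    -- arrival time in P) is active, and the epoch at t has just been processed.
    -- The phase ends at the trigger time τ unless another epoch arrives at or
    -- before τ; that epoch is then processed before the test is repeated.
    idle   : Point → List Carrier → Schedule I
    start  : Point → List (Request I) → Carrier → List Carrier → Schedule I
    active : Point → Carrier → List⁺ (Request I) → Carrier → List Carrier → Schedule I

    idle s []       = []
    idle s (t ∷ ts) = serveAtAnchor s t ∷ start s (awayFromAnchor s t) t ts

    start s []      t ts = idle s ts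
    start s (q ∷ P) t ts = active s t (q ∷ P) t ts

    active s α P t []        = endPhase s P (trigger s α P t) ∷ []
    active s α P t (t′ ∷ ts) =
      if does (t′ ≤? trigger s α P t)
        then serveAtAnchor s t′ ∷ active s α (P ⁺++ awayFromAnchor s t′) t′ ts
        else endPhase s P (trigger s α P t) ∷ idle (nextAnchor s P) (t′ ∷ ts)

    schedule : Point → Schedule I
    schedule s₀ = idle s₀ epochTimes

    ALG : Point → Carrier
    ALG s₀ = cost I (schedule s₀)

{-# OPTIONS --safe #-}

-- Fix an offline schedule and use twice the distance between the anchor s and
-- the offline server o as potential.  Let a phase start at time α with anchor s,
-- let F be its final Steiner tree, of weight S, and p its farthest request, at
-- depth h in F.  Arrivals only raise the Steiner cost, so the test first succeeds
-- with equality: the phase ends at τ = α + S, and it costs at most 2S - h for the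
-- walk and S for the delay.
--
-- Since the previous trigger time, let the offline server move by l to o′, and let
-- D be the largest delay at time τ of a request of the phase that is still
-- pending offline.  All requests of the phase that arrived before τ - D have been
-- visited offline, and just before τ - D the Steiner cost was at least S - D.
-- Joining s to the offline walk gives S ≤ d(s,o) + l + D.
--
-- If the first request q of the phase is pending then D ≥ S.  Otherwise q was
-- visited; two vertices of F at depths g ≤ h satisfy d(q,p) + g + h ≤ 2S, which
-- bounds d(p,o′).  In both cases 3S - h + 2 d(p,o′) ≤ 12 (l + D) + 2 d(s,o).
-- Summing over the phases gives the factor 12, because a pending delay is charged
-- to a phase only for the part accruing after the previous trigger time.

module Submission where

open import Defs
open import Level using (_⊔_)
import Algebra.Construct.NaturalChoice.Max as Max
import Algebra.Construct.NaturalChoice.Min as Min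
import Algebra.Construct.NaturalChoice.MinMaxOp as MinMaxOp
import Algebra.Properties.Ring as RingProperties
import Algebra.Properties.Semiring.Mult as SemiringMult
import Algebra.Solver.CommutativeMonoid as CommutativeMonoidSolver
import Algebra.Solver.CommutativeMonoid.Normal as CommutativeMonoidNormal
open import Data.List.Base
  using (List; []; _∷_; _++_; map; filter; deduplicate; tabulate; allFin; initLast; _∷ʳ′_)
import Data.List.Extrema as Extrema
open import Data.List.Membership.Propositional using (_∈_; _∉_)
import Data.List.Membership.DecPropositional as DecMembership
open import Data.List.Membership.Propositional.Properties
  using (∈-++⁻; ∈-++⁺ˡ; ∈-++⁺ʳ; ∈-map⁺; ∈-map⁻; ∈-filter⁻; ∈-deduplicate⁺)
open import Data.List.NonEmpty.Base using (List⁺; _∷_; last; toList; head; _⁺++_)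
open import Data.List.Properties using (++-assoc; ++-identityʳ)
open import Data.List.Relation.Binary.Permutation.Propositional using (↭-sym)
open import Data.List.Relation.Binary.Permutation.Propositional.Properties using (All-resp-↭)
open import Data.List.Relation.Binary.Subset.Propositional using (_⊆_)
open import Data.List.Relation.Unary.All as All using (All; []; _∷_)
import Data.List.Relation.Unary.All.Properties as All
open import Data.List.Relation.Unary.AllPairs as AllPairs using (AllPairs; []; _∷_)
import Data.List.Relation.Unary.AllPairs.Properties as AllPairs
open import Data.List.Relation.Unary.Any using (Any; here; there)
open import Data.List.Relation.Unary.Linked.Properties using (Linked⇒AllPairs)
open import Data.List.Relation.Unary.Unique.Propositional using (Unique)
open import Data.List.Relation.Unary.Unique.DecPropositional.Properties using (deduplicate-!)
import Data.List.Sort as Sort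
open import Data.Nat.Base using (ℕ; zero; suc)
open import Data.Product.Base using (∃; _×_; _,_; proj₁; proj₂)
open import Data.Sum.Base using (_⊎_; inj₁; inj₂; map₂)
open import Data.Vec.Base as Vec using (Vec; []; _∷_)
open import Function.Base using (_on_)
open import Function.Metric.Structures using (IsGeneralMetric)
open import Relation.Binary.Bundles using (DecTotalOrder)
open import Relation.Binary.PropositionalEquality.Core as ≡ using (_≡_; refl; subst)
import Relation.Binary.Reasoning.PartialOrder as ≤-Reasoning
open import Relation.Nullary.Decidable using (True; toWitness; yes; no; ¬?)
open import Relation.Nullary.Negation using (¬_; contradiction)
open import Relation.Unary using (Pred; Decidable)

-- Arithmetic in ordered fields.

module OrderedFieldProperties {c ℓ₁ ℓ₂} (K : OrderedField c ℓ₁ ℓ₂) where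

  open OrderedField K hiding (refl)
  open DecTotalOrder decTotalOrder public
    using (poset; total; antisym; module Eq)
    renaming (refl to ≤-refl; trans to ≤-trans; reflexive to ≤-reflexive)
  open ≤-Reasoning poset
  open RingProperties ring using (-1*x≈-x; -‿involutive)
  open SemiringMult semiring using (×-congʳ; ×-assoc-*)

  infixl 6 _⊞_
  _⊞_ : ∀ {x y u v} → x ≤ y → u ≤ v → x + u ≤ y + v
  _⊞_ {x} {y} {u} {v} x≤y u≤v = begin
    x + u ≤⟨ +-monoʳ-≤ x u≤v ⟩
    x + v ≈⟨ +-comm x v ⟩
    v + x ≤⟨ +-monoʳ-≤ v x≤y ⟩
    v + y ≈⟨ +-comm v y ⟩
    y + v ∎

  ·-monoʳ-≤ : ∀ n {x y} → x ≤ y → n · x ≤ n · y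
  ·-monoʳ-≤ zero    x≤y = ≤-refl
  ·-monoʳ-≤ (suc n) x≤y = x≤y ⊞ ·-monoʳ-≤ n x≤y

  x+y-y≈x : ∀ x y → (x + y) - y ≈ x
  x+y-y≈x x y = begin-equality
    (x + y) - y  ≈⟨ +-assoc x y (- y) ⟩
    x + (y - y)  ≈⟨ +-congˡ (-‿inverseʳ y) ⟩
    x + 0#       ≈⟨ +-identityʳ x ⟩
    x            ∎

  +-cancelʳ-≤ : ∀ z {x y} → x + z ≤ y + z → x ≤ y
  +-cancelʳ-≤ z {x} {y} x+z≤y+z = begin
    x            ≈⟨ x+y-y≈x x z ⟨
    (x + z) - z  ≤⟨ x+z≤y+z ⊞ ≤-refl ⟩
    (y + z) - z  ≈⟨ x+y-y≈x y z ⟩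
    y            ∎

  -- Checked certificates for linear inequalities.

  module LinearArithmetic where

    open CommutativeMonoidSolver +-commutativeMonoid public
      using (Expr; id; _⊕_)
    open CommutativeMonoidSolver +-commutativeMonoid
      using (var; ⟦_⟧; ⟦_⟧⇓; normalise) renaming (_≟_ to _≟ⁿ_)
    open CommutativeMonoidNormal +-commutativeMonoid using (correct)

    infixr 8 _⊗_
    _⊗_ : ∀ {n} → ℕ → Expr n → Expr n
    zero  ⊗ e = id
    suc k ⊗ e = e ⊕ k ⊗ e

    infix 4 _≼_
    record Inequality (n : ℕ) : Set where
      constructor _≼_
      field lower upper : Expr n
    open Inequality

    Holds : ∀ {n} → Vec Carrier n → Inequality n → Set ℓ₂
    Holds ρ (l ≼ u) = ⟦ l ⟧ ρ ≤ ⟦ u ⟧ ρ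

    infixr 3 _⊛_,_
    data Premises (n : ℕ) : Set where
      none : Premises n
      _⊛_,_ : ℕ → Inequality n → Premises n → Premises n

    summed : ∀ {n} → Premises n → Inequality n
    summed none = id ≼ id
    summed (k ⊛ l ≼ u , ps) = (k ⊗ l ⊕ lower (summed ps)) ≼ (k ⊗ u ⊕ upper (summed ps))

    data AllHold {n} (ρ : Vec Carrier n) : Premises n → Set ℓ₂ where
      [] : AllHold ρ none
      _∷_ : ∀ {k i ps} → Holds ρ i → AllHold ρ ps → AllHold ρ (k ⊛ i , ps)

    ⟦⊗⟧ : ∀ {n} (ρ : Vec Carrier n) k e → ⟦ k ⊗ e ⟧ ρ ≈ k · ⟦ e ⟧ ρ
    ⟦⊗⟧ ρ zero e = Eq.refl
    ⟦⊗⟧ ρ (suc k) e = +-congˡ (⟦⊗⟧ ρ k e)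

    summed-holds : ∀ {n} {ρ : Vec Carrier n} {ps} → AllHold ρ ps → Holds ρ (summed ps)
    summed-holds [] = ≤-refl
    summed-holds {ρ = ρ} {k ⊛ l ≼ u , ps} (h ∷ hs) = (begin
      ⟦ k ⊗ l ⟧ ρ ≈⟨ ⟦⊗⟧ ρ k l ⟩
      k · ⟦ l ⟧ ρ ≤⟨ ·-monoʳ-≤ k h ⟩
      k · ⟦ u ⟧ ρ ≈⟨ ⟦⊗⟧ ρ k u ⟨
      ⟦ k ⊗ u ⟧ ρ ∎) ⊞ summed-holds hs

    infix 2 _⊢_
    record Certificate (n : ℕ) : Set where
      constructor _⊢_
      field
        premises   : Premises n
        conclusion : Inequality n

      -- conclusion: l ≤ u; the premises sum to s ≤ t; checks u + s = l + t.
      lhs rhs : Expr n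
      lhs = upper conclusion ⊕ lower (summed premises)
      rhs = lower conclusion ⊕ upper (summed premises)
    open Certificate

    -- A Farkas certificate: the premises carry natural multipliers, and the two sides are compared
    -- crosswise in the commutative monoid, without subtraction, before `t` is cancelled. Negatives
    -- such as `- y` are opaque atoms, tied to `y` by explicit premises such as `0≤x-x`. The
    -- implicit argument is settled by evaluation.
    linear : ∀ {n} (ρ : Vec Carrier n) (f : Vec (Expr n) n → Certificate n) →
             let cert = f (Vec.map var (Vec.allFin n)) in
             {True (normalise (lhs cert) ≟ⁿ normalise (rhs cert))} →
             AllHold ρ (premises cert) → Holds ρ (conclusion cert)
    linear {n} ρ f {eq} hs = +-cancelʳ-≤ (⟦ t ⟧ ρ) (begin
      ⟦ a ⟧ ρ + ⟦ t ⟧ ρ             ≈⟨ correct (rhs cert) ρ ⟨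
      ⟦ normalise (rhs cert) ⟧⇓ ρ  ≡⟨ ≡.cong (λ e → ⟦ e ⟧⇓ ρ) (toWitness eq) ⟨
      ⟦ normalise (lhs cert) ⟧⇓ ρ  ≈⟨ correct (lhs cert) ρ ⟩
      ⟦ b ⟧ ρ + ⟦ s ⟧ ρ             ≤⟨ +-monoʳ-≤ _ (summed-holds hs) ⟩
      ⟦ b ⟧ ρ + ⟦ t ⟧ ρ             ∎)
      where
      cert = f (Vec.map var (Vec.allFin n))
      a = lower (conclusion cert)
      b = upper (conclusion cert)
      s = lower (summed (premises cert))
      t = upper (summed (premises cert))

  open LinearArithmetic public using (linear; _⊢_; none; _⊛_,_; _≼_; _⊕_; _⊗_; id; []; _∷_)

  x-x≤0 : ∀ x → x - x ≤ 0#
  x-x≤0 x = ≤-reflexive (-‿inverseʳ x)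

  0≤x-x : ∀ x → 0# ≤ x - x
  0≤x-x x = ≤-reflexive (sym (-‿inverseʳ x))

  x≤y⇒0≤y-x : ∀ {x y} → x ≤ y → 0# ≤ y - x
  x≤y⇒0≤y-x {x} {y} x≤y = linear (x ∷ y ∷ - x ∷ [])
    (λ { (x ∷ y ∷ -x ∷ []) → 1 ⊛ x ≼ y , 1 ⊛ id ≼ x ⊕ -x , none ⊢ id ≼ y ⊕ -x })
    (x≤y ∷ 0≤x-x x ∷ [])

  x-y≤z⇒x≤y+z : ∀ {x y z} → x - y ≤ z → x ≤ y + z
  x-y≤z⇒x≤y+z {x} {y} {z} x-y≤z = linear (x ∷ y ∷ z ∷ - y ∷ [])
    (λ { (x ∷ y ∷ z ∷ -y ∷ []) → 1 ⊛ x ⊕ -y ≼ z , 1 ⊛ id ≼ y ⊕ -y , none ⊢ x ≼ y ⊕ z })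
    (x-y≤z ∷ 0≤x-x y ∷ [])

  ≰⇒≥ : ∀ {x y} → ¬ (x ≤ y) → y ≤ x
  ≰⇒≥ {x} {y} x≰y with total x y
  ... | inj₁ x≤y = contradiction x≤y x≰y
  ... | inj₂ y≤x = y≤x

  x≤x+y : ∀ x {y} → 0# ≤ y → x ≤ x + y
  x≤x+y x {y} 0≤y = linear (x ∷ y ∷ [])
    (λ { (x ∷ y ∷ []) → 1 ⊛ id ≼ y , none ⊢ x ≼ x ⊕ y })
    (0≤y ∷ [])

  0≤1 : 0# ≤ 1#
  0≤1 with total 0# 1#
  ... | inj₁ 0≤1 = 0≤1
  ... | inj₂ 1≤0 = begin
    0#           ≤⟨ *-nonNegative 0≤-1 0≤-1 ⟩
    - 1# * - 1#  ≈⟨ -1*x≈-x (- 1#) ⟩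
    - - 1#       ≈⟨ -‿involutive 1# ⟩
    1#           ∎
    where
    0≤-1 : 0# ≤ - 1#
    0≤-1 = linear (1# ∷ - 1# ∷ [])
      (λ { (e ∷ -e ∷ []) → 1 ⊛ e ≼ id , 1 ⊛ id ≼ e ⊕ -e , none ⊢ id ≼ -e })
      (1≤0 ∷ 0≤x-x 1# ∷ [])

  0≰-1 : ¬ (0# ≤ - 1#)
  0≰-1 0≤-1 = 0≉1 (antisym 0≤1 (linear (1# ∷ - 1# ∷ [])
    (λ { (e ∷ -e ∷ []) → 1 ⊛ id ≼ -e , 1 ⊛ e ⊕ -e ≼ id , none ⊢ e ≼ id })
    (0≤-1 ∷ x-x≤0 1# ∷ [])))

  -- In terms of a phase: S is the Steiner cost, W the length of the open walk, l and
  -- D the offline movement and pending delay, x and y the distances between anchor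
  -- and offline server before and after the phase.
  module _ {S W l D x y : Carrier} where

    -- In its application `g` and `h` are the tree depths of the first and the farthest request, `e`
    -- is their distance, and `m₁`, `m₂` are the distances from the first request to the old and the
    -- new offline position. The left side is at most 7S - 3h - 2g + 2m₂, hence at most 7S - 5g +
    -- 2m₂. Here 7S costs 7(x + l + D), while 5g gives back 5(x - m₁). What remains is 2x + 7D + 7l
    -- + 5m₁ + 2m₂, and m₁ + m₂ ≤ l makes the movement 12l: this case sets the constant.
    amortised-served : ∀ {h g e e′ m₁ m₁′ m₂ f} →
      S ≤ x + (l + D) → x ≤ f + m₁′ → m₁′ ≤ m₁ → f ≤ g → g ≤ h → e + (g + h) ≤ 2 · S →
      e′ ≤ e → y ≤ e′ + m₂ → m₁ + m₂ ≤ l → 0# ≤ m₂ → 0# ≤ D → W + h ≤ 2 · S →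
      (W + S) + 2 · y ≤ 12 · (l + D) + 2 · x
    amortised-served {h} {g} {e} {e′} {m₁} {m₁′} {m₂} {f} p₁ p₂ p₃ p₄ p₅ p₆ p₇ p₈ p₉ p₁₀ p₁₁ p₁₂ =
      linear (S ∷ x ∷ l ∷ D ∷ g ∷ h ∷ e ∷ e′ ∷ y ∷ m₁ ∷ m₁′ ∷ m₂ ∷ f ∷ W ∷ [])
        (λ { (S ∷ x ∷ l ∷ D ∷ g ∷ h ∷ e ∷ e′ ∷ y ∷ m₁ ∷ m₁′ ∷ m₂ ∷ f ∷ W ∷ []) →
             7 ⊛ S ≼ x ⊕ (l ⊕ D) ,
             5 ⊛ x ≼ f ⊕ m₁′ ,
             5 ⊛ m₁′ ≼ m₁ ,
             5 ⊛ f ≼ g ,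
             3 ⊛ g ≼ h ,
             2 ⊛ e ⊕ (g ⊕ h) ≼ 2 ⊗ S ,
             2 ⊛ e′ ≼ e ,
             2 ⊛ y ≼ e′ ⊕ m₂ ,
             5 ⊛ m₁ ⊕ m₂ ≼ l ,
             3 ⊛ id ≼ m₂ ,
             5 ⊛ id ≼ D ,
             1 ⊛ W ⊕ h ≼ 2 ⊗ S , none
             ⊢ (W ⊕ S) ⊕ 2 ⊗ y ≼ 12 ⊗ (l ⊕ D) ⊕ 2 ⊗ x })
        (p₁ ∷ p₂ ∷ p₃ ∷ p₄ ∷ p₅ ∷ p₆ ∷ p₇ ∷ p₈ ∷ p₉ ∷ p₁₀ ∷ p₁₁ ∷ p₁₂ ∷ [])

    -- Routing through the old anchor gives y ≤ h + x + l, so the left side is at most 3S + h + 2x +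
    -- 2l ≤ 4D + 2x + 2l, well within the budget.
    amortised-pending : ∀ {h e e′ f m} →
      S ≤ D → h ≤ S → y ≤ e + f → e ≤ e′ → e′ ≤ h → f ≤ x + m → m ≤ l →
      W + h ≤ 2 · S → 0# ≤ l → 0# ≤ D →
      (W + S) + 2 · y ≤ 12 · (l + D) + 2 · x
    amortised-pending {h} {e} {e′} {f} {m} p₁ p₂ p₃ p₄ p₅ p₆ p₇ p₈ p₉ p₁₀ =
      linear (S ∷ x ∷ l ∷ D ∷ h ∷ y ∷ e ∷ e′ ∷ f ∷ m ∷ W ∷ [])
        (λ { (S ∷ x ∷ l ∷ D ∷ h ∷ y ∷ e ∷ e′ ∷ f ∷ m ∷ W ∷ []) →
             4 ⊛ S ≼ D ,
             1 ⊛ h ≼ S ,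
             2 ⊛ y ≼ e ⊕ f ,
             2 ⊛ e ≼ e′ ,
             2 ⊛ e′ ≼ h ,
             2 ⊛ f ≼ x ⊕ m ,
             2 ⊛ m ≼ l ,
             1 ⊛ W ⊕ h ≼ 2 ⊗ S ,
             10 ⊛ id ≼ l ,
             8 ⊛ id ≼ D , none
             ⊢ (W ⊕ S) ⊕ 2 ⊗ y ≼ 12 ⊗ (l ⊕ D) ⊕ 2 ⊗ x })
        (p₁ ∷ p₂ ∷ p₃ ∷ p₄ ∷ p₅ ∷ p₆ ∷ p₇ ∷ p₈ ∷ p₉ ∷ p₁₀ ∷ [])

    amortised-step : ∀ {δ C R R₁ R₂} →
      (W + S) + 2 · y ≤ 12 · (l + D) + 2 · x → δ ≤ S → C ≤ 12 · R₂ + 2 · y →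
      l + R₁ ≤ R → D + R₂ ≤ R₁ → (W + δ) + C ≤ 12 · R + 2 · x
    amortised-step {δ} {C} {R} {R₁} {R₂} p₁ p₂ p₃ p₄ p₅ =
      linear (W ∷ δ ∷ C ∷ y ∷ l ∷ D ∷ x ∷ R ∷ R₁ ∷ R₂ ∷ S ∷ [])
        (λ { (W ∷ δ ∷ C ∷ y ∷ l ∷ D ∷ x ∷ R ∷ R₁ ∷ R₂ ∷ S ∷ []) →
             1 ⊛ (W ⊕ S) ⊕ 2 ⊗ y ≼ 12 ⊗ (l ⊕ D) ⊕ 2 ⊗ x ,
             1 ⊛ δ ≼ S ,
             1 ⊛ C ≼ 12 ⊗ R₂ ⊕ 2 ⊗ y ,
             12 ⊛ l ⊕ R₁ ≼ R ,
             12 ⊛ D ⊕ R₂ ≼ R₁ , none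
             ⊢ (W ⊕ δ) ⊕ C ≼ 12 ⊗ R ⊕ 2 ⊗ x })
        (p₁ ∷ p₂ ∷ p₃ ∷ p₄ ∷ p₅ ∷ [])

  ·-cancelˡ-≤ : ∀ n {x y} → suc n · x ≤ suc n · y → x ≤ y
  ·-cancelˡ-≤ n {x} {y} nx≤ny with total x y
  ... | inj₁ x≤y = x≤y
  -- Removing `n` copies of `y ≤ x` from the hypothesis leaves a single copy of the goal.
  ... | inj₂ y≤x = linear (x ∷ y ∷ n · x ∷ n · y ∷ [])
    (λ { (x ∷ y ∷ nx ∷ ny ∷ []) → 1 ⊛ x ⊕ nx ≼ y ⊕ ny , 1 ⊛ ny ≼ nx , none ⊢ x ≼ y })
    (nx≤ny ∷ ·-monoʳ-≤ n y≤x ∷ [])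

  0≤n·1 : ∀ n → 0# ≤ n · 1#
  0≤n·1 zero    = ≤-refl
  0≤n·1 (suc n) = ≤-trans (0≤n·1 n) (≤-trans (x≤x+y (n · 1#) 0≤1) (≤-reflexive (+-comm _ _)))

  ·-divisible : ∀ n x → ∃ λ y → suc n · y ≈ x
  ·-divisible n x = i * x , (begin-equality
    suc n · (i * x)         ≈⟨ ×-congʳ (suc n) (*-identityˡ (i * x)) ⟨
    suc n · (1# * (i * x))  ≈⟨ ×-assoc-* (suc n) 1# (i * x) ⟨
    (suc n · 1#) * (i * x)  ≈⟨ *-assoc _ _ _ ⟨
    ((suc n · 1#) * i) * x  ≈⟨ *-congʳ (proj₂ inv) ⟩
    1# * x                  ≈⟨ *-identityˡ x ⟩
    x                       ∎)
    where
    n≉0 : ¬ (suc n · 1# ≈ 0#)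
    n≉0 n≈0 = 0≉1 (antisym 0≤1 (≤-trans (x≤x+y 1# (0≤n·1 n)) (≤-reflexive n≈0)))
    inv = inverse (suc n · 1#) n≉0
    i = proj₁ inv

-- Walks and trees in a finite metric space.

module MetricProperties {c ℓ₁ ℓ₂} (K : OrderedField c ℓ₁ ℓ₂) (M : FiniteMetricSpace K) where

  open OrderedField K hiding (refl)
  open OrderedFieldProperties K
  open FiniteMetricSpace M
  open IsGeneralMetric isMetric public
    using (triangle) renaming (nonNegative to d-nonNegative; sym to d-sym; ≈⇒0 to d-zero)
  open Online K M
  open DecMembership _≟ᵖ_ using (_∈?_)

  d-refl : ∀ x → d x x ≤ 0#
  d-refl x = ≤-reflexive (d-zero refl)

  d-comm : ∀ x y → d x y ≤ d y x
  d-comm x y = ≤-reflexive (d-sym x y)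

  pathLength-nonNegative : ∀ xs → 0# ≤ pathLength xs
  pathLength-nonNegative []           = ≤-refl
  pathLength-nonNegative (x ∷ [])     = ≤-refl
  pathLength-nonNegative (x ∷ y ∷ zs) =
    linear (d x y ∷ pathLength (y ∷ zs) ∷ [])
      (λ { (e ∷ l ∷ []) → 1 ⊛ id ≼ e , 1 ⊛ id ≼ l , none ⊢ id ≼ e ⊕ l })
      (d-nonNegative ∷ pathLength-nonNegative (y ∷ zs) ∷ [])

  last-∷ : ∀ (x y : Point) ys → last (x ∷ y ∷ ys) ≡ last (y ∷ ys)
  last-∷ x y ys with initLast ys
  ... | []      = refl
  ... | _ ∷ʳ′ _ = refl

  last-++ : ∀ (x : Point) xs ys → last (x ∷ xs ++ ys) ≡ last (last (x ∷ xs) ∷ ys)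
  last-++ x []       ys = refl
  last-++ x (y ∷ xs) ys rewrite last-∷ x y (xs ++ ys) | last-∷ x y xs = last-++ y xs ys

  pathLength-++ : ∀ x xs ys →
    pathLength (x ∷ xs ++ ys) ≤ pathLength (x ∷ xs) + pathLength (last (x ∷ xs) ∷ ys)
  pathLength-++ x [] ys = linear (pathLength (x ∷ ys) ∷ [])
    (λ { (l ∷ []) → none ⊢ l ≼ id ⊕ l }) []
  pathLength-++ x (y ∷ xs) ys rewrite last-∷ x y xs =
    linear (d x y ∷ pathLength (y ∷ xs ++ ys) ∷ pathLength (y ∷ xs)
             ∷ pathLength (last (y ∷ xs) ∷ ys) ∷ [])
      (λ { (e ∷ l ∷ l₁ ∷ l₂ ∷ []) →
           1 ⊛ l ≼ l₁ ⊕ l₂ , none ⊢ e ⊕ l ≼ (e ⊕ l₁) ⊕ l₂ })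
      (pathLength-++ y xs ys ∷ [])

  d-last≤pathLength : ∀ x xs → d x (last (x ∷ xs)) ≤ pathLength (x ∷ xs)
  d-last≤pathLength x []       = d-refl x
  d-last≤pathLength x (y ∷ xs) rewrite last-∷ x y xs =
    ≤-trans (triangle x y (last (y ∷ xs))) (+-monoʳ-≤ (d x y) (d-last≤pathLength y xs))

  -- Cutting the walk at a visit to `v` bounds each half by the distance of its ends. Both legs are
  -- kept because the amortisation weighs them differently.
  detour≤pathLength : ∀ {v} x xs → v ∈ x ∷ xs →
    d x v + d v (last (x ∷ xs)) ≤ pathLength (x ∷ xs)
  detour≤pathLength x xs (here refl) =
    linear (d x x ∷ d x (last (x ∷ xs)) ∷ pathLength (x ∷ xs) ∷ [])
      (λ { (z ∷ e ∷ l ∷ []) → 1 ⊛ z ≼ id , 1 ⊛ e ≼ l , none ⊢ z ⊕ e ≼ l })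
      (d-refl x ∷ d-last≤pathLength x xs ∷ [])
  detour≤pathLength {v} x (y ∷ xs) (there v∈) rewrite last-∷ x y xs =
    linear (d x v ∷ d x y ∷ d y v ∷ d v (last (y ∷ xs)) ∷ pathLength (y ∷ xs) ∷ [])
      (λ { (xv ∷ xy ∷ yv ∷ e ∷ l ∷ []) →
           1 ⊛ xv ≼ xy ⊕ yv , 1 ⊛ yv ⊕ e ≼ l , none ⊢ xv ⊕ e ≼ xy ⊕ l })
      (triangle x y v ∷ detour≤pathLength y xs v∈ ∷ [])

  pathLength-skip : ∀ x y ys → pathLength (x ∷ ys) ≤ pathLength (x ∷ y ∷ ys)
  pathLength-skip x y []       = pathLength-nonNegative (x ∷ y ∷ [])
  pathLength-skip x y (z ∷ zs) =
    linear (d x z ∷ d x y ∷ d y z ∷ pathLength (z ∷ zs) ∷ [])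
      (λ { (xz ∷ xy ∷ yz ∷ l ∷ []) →
           1 ⊛ xz ≼ xy ⊕ yz , none ⊢ xz ⊕ l ≼ xy ⊕ (yz ⊕ l) })
      (triangle x y z ∷ [])

  pathLength-filter : ∀ {p} {P : Pred Point p} (P? : Decidable P) x xs →
    pathLength (x ∷ filter P? xs) ≤ pathLength (x ∷ xs)
  pathLength-filter P? x []       = ≤-refl
  pathLength-filter P? x (y ∷ ys) with P? y
  ... | yes _ = +-monoʳ-≤ (d x y) (pathLength-filter P? y ys)
  ... | no  _ = ≤-trans (pathLength-filter P? x ys) (pathLength-skip x y ys)

  pathLength-deduplicate : ∀ xs → pathLength (deduplicate _≟ᵖ_ xs) ≤ pathLength xs
  pathLength-deduplicate []           = ≤-refl
  pathLength-deduplicate (x ∷ [])     = ≤-refl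
  pathLength-deduplicate (x ∷ y ∷ ys) =
    ≤-trans (pathLength-filter (λ z → ¬? (x ≟ᵖ z)) x (deduplicate _≟ᵖ_ (y ∷ ys)))
            (+-monoʳ-≤ (d x y) (pathLength-deduplicate (y ∷ ys)))

  chain : List Point → List Tree
  chain []       = []
  chain (x ∷ xs) = node x (chain xs) ∷ []

  forestVertices-chain : ∀ xs → forestVertices (chain xs) ≡ xs
  forestVertices-chain []       = refl
  forestVertices-chain (x ∷ xs)
    rewrite ++-identityʳ (forestVertices (chain xs)) = ≡.cong (x ∷_) (forestVertices-chain xs)

  branchWeight-chain : ∀ x xs → branchWeight x (chain xs) ≤ pathLength (x ∷ xs)
  branchWeight-chain x []       = ≤-refl
  branchWeight-chain x (y ∷ ys) =
    linear (d x y ∷ branchWeight y (chain ys) ∷ pathLength (y ∷ ys) ∷ [])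
      (λ { (e ∷ w ∷ l ∷ []) → 1 ⊛ w ≼ l , none ⊢ (e ⊕ w) ⊕ id ≼ e ⊕ l })
      (branchWeight-chain y ys ∷ [])

  -- Repeated vertices are shortcut, which by the triangle inequality does not lengthen the walk,
  -- and the remaining simple path is itself a tree.
  spanningTree : ∀ x xs → ∃ λ T →
    IsTree T × (∀ {v} → v ∈ x ∷ xs → v ∈ vertices T) × weight T ≤ pathLength (x ∷ xs)
  spanningTree x xs =
    node x (chain ys) ,
    subst Unique (≡.sym vertices≡) (deduplicate-! _≟ᵖ_ (x ∷ xs)) ,
    (λ {v} v∈ → subst (v ∈_) (≡.sym vertices≡) (∈-deduplicate⁺ _≟ᵖ_ v∈)) ,
    ≤-trans (branchWeight-chain x ys) (pathLength-deduplicate (x ∷ xs))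
    where
    -- Chosen so that `x ∷ ys` is definitionally `deduplicate _≟ᵖ_ (x ∷ xs)`.
    ys = filter (λ z → ¬? (x ≟ᵖ z)) (deduplicate _≟ᵖ_ xs)
    vertices≡ = ≡.cong (x ∷_) (forestVertices-chain ys)

  -- Weights, depths and depth-first walks of rooted trees.

  weight-nonNegative : ∀ T → 0# ≤ weight T
  branchWeight-nonNegative : ∀ x Ts → 0# ≤ branchWeight x Ts
  weight-nonNegative (node x Ts) = branchWeight-nonNegative x Ts
  branchWeight-nonNegative x []       = ≤-refl
  branchWeight-nonNegative x (T ∷ Ts) =
    linear (d x (root T) ∷ weight T ∷ branchWeight x Ts ∷ [])
      (λ { (e ∷ w ∷ b ∷ []) →
           1 ⊛ id ≼ e , 1 ⊛ id ≼ w , 1 ⊛ id ≼ b , none ⊢ id ≼ (e ⊕ w) ⊕ b })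
      (d-nonNegative ∷ weight-nonNegative T ∷ branchWeight-nonNegative x Ts ∷ [])

  treeDist≤weight : ∀ T v → treeDist T v ≤ weight T
  branchDist≤branchWeight : ∀ x Ts v → branchDist x Ts v ≤ branchWeight x Ts
  treeDist≤weight (node x Ts) = branchDist≤branchWeight x Ts
  branchDist≤branchWeight x []       v = ≤-refl
  branchDist≤branchWeight x (T ∷ Ts) v with v ∈? vertices T
  ... | yes _ =
    linear (d x (root T) ∷ treeDist T v ∷ weight T ∷ branchWeight x Ts ∷ [])
      (λ { (e ∷ t ∷ w ∷ b ∷ []) →
           1 ⊛ t ≼ w , 1 ⊛ id ≼ b , none ⊢ e ⊕ t ≼ (e ⊕ w) ⊕ b })
      (treeDist≤weight T v ∷ branchWeight-nonNegative x Ts ∷ [])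
  ... | no _ =
    linear (d x (root T) ∷ branchDist x Ts v ∷ weight T ∷ branchWeight x Ts ∷ [])
      (λ { (e ∷ t ∷ w ∷ b ∷ []) →
           1 ⊛ id ≼ e , 1 ⊛ id ≼ w , 1 ⊛ t ≼ b , none ⊢ t ≼ (e ⊕ w) ⊕ b })
      (d-nonNegative ∷ weight-nonNegative T ∷ branchDist≤branchWeight x Ts v ∷ [])

  treeDist-nonNegative : ∀ T v → 0# ≤ treeDist T v
  branchDist-nonNegative : ∀ x Ts v → 0# ≤ branchDist x Ts v
  treeDist-nonNegative (node x Ts) = branchDist-nonNegative x Ts
  branchDist-nonNegative x []       v = ≤-refl
  branchDist-nonNegative x (T ∷ Ts) v with v ∈? vertices T
  ... | yes _ =
    linear (d x (root T) ∷ treeDist T v ∷ [])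
      (λ { (e ∷ t ∷ []) → 1 ⊛ id ≼ e , 1 ⊛ id ≼ t , none ⊢ id ≼ e ⊕ t })
      (d-nonNegative ∷ treeDist-nonNegative T v ∷ [])
  ... | no _ = branchDist-nonNegative x Ts v

  ∈-otherBranches : ∀ x T Ts {v} → v ∉ vertices T →
    v ∈ x ∷ forestVertices (T ∷ Ts) → v ∈ x ∷ forestVertices Ts
  ∈-otherBranches x T Ts v∉T (here v≡x) = here v≡x
  ∈-otherBranches x T Ts v∉T (there v∈) with ∈-++⁻ (vertices T) v∈
  ... | inj₁ v∈T  = contradiction v∈T v∉T
  ... | inj₂ v∈Ts = there v∈Ts

  d≤treeDist : ∀ T {v} → v ∈ vertices T → d (root T) v ≤ treeDist T v
  d≤branchDist : ∀ x Ts {v} → v ∈ x ∷ forestVertices Ts → d x v ≤ branchDist x Ts v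
  d≤treeDist (node x Ts) = d≤branchDist x Ts
  -- A branch might repeat the label `x`, so `branchDist` at `x` is only known to be nonnegative.
  d≤branchDist x Ts (here refl) = ≤-trans (d-refl x) (branchDist-nonNegative x Ts x)
  d≤branchDist x (T ∷ Ts) {v} (there v∈) with v ∈? vertices T
  ... | yes v∈T = ≤-trans (triangle x (root T) v) (+-monoʳ-≤ _ (d≤treeDist T v∈T))
  ... | no  v∉T = d≤branchDist x Ts (∈-otherBranches x T Ts v∉T (there v∈))

  -- The tree paths from `x` to `u` and `v` lie in different branches, so their combined length is
  -- at most the total weight; it also bounds `d u v`, whence the factor 2.
  distinctBranches : ∀ x T Ts {u v} → u ∈ vertices T → v ∈ x ∷ forestVertices Ts →
    d u v + ((d x (root T) + treeDist T u) + branchDist x Ts v) ≤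
    2 · ((d x (root T) + weight T) + branchWeight x Ts)
  distinctBranches x T Ts {u} {v} u∈T v∈ =
    linear (d u v ∷ d u x ∷ d x u ∷ d x v ∷ d x (root T) ∷ d (root T) u ∷ treeDist T u
             ∷ branchDist x Ts v ∷ weight T ∷ branchWeight x Ts ∷ [])
      (λ { (uv ∷ ux ∷ xu ∷ xv ∷ e ∷ ru ∷ tu ∷ tv ∷ w ∷ b ∷ []) →
           1 ⊛ uv ≼ ux ⊕ xv , 1 ⊛ ux ≼ xu , 1 ⊛ xu ≼ e ⊕ ru , 1 ⊛ ru ≼ tu , 1 ⊛ xv ≼ tv ,
           2 ⊛ tu ≼ w , 2 ⊛ tv ≼ b , none
           ⊢ uv ⊕ ((e ⊕ tu) ⊕ tv) ≼ 2 ⊗ ((e ⊕ w) ⊕ b) })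
      (triangle u x v ∷ d-comm u x ∷ triangle x (root T) u ∷ d≤treeDist T u∈T
        ∷ d≤branchDist x Ts v∈ ∷ treeDist≤weight T u ∷ branchDist≤branchWeight x Ts v ∷ [])

  -- With z the length of the common part of the tree paths from the root to u
  -- and v, both d u v ≤ treeDist u + treeDist v - 2z and
  -- treeDist u + treeDist v - z ≤ weight.
  tripod : ∀ T {u v} → u ∈ vertices T → v ∈ vertices T →
    d u v + (treeDist T u + treeDist T v) ≤ 2 · weight T
  branchTripod : ∀ x Ts {u v} → u ∈ x ∷ forestVertices Ts → v ∈ x ∷ forestVertices Ts →
    d u v + (branchDist x Ts u + branchDist x Ts v) ≤ 2 · branchWeight x Ts
  tripod (node x Ts) = branchTripod x Ts
  branchTripod x [] (here refl) (here refl) =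
    linear (d x x ∷ [])
      (λ { (z ∷ []) → 1 ⊛ z ≼ id , none ⊢ z ⊕ (id ⊕ id) ≼ 2 ⊗ id })
      (d-refl x ∷ [])
  branchTripod x (T ∷ Ts) {u} {v} u∈ v∈ with u ∈? vertices T | v ∈? vertices T
  -- Both depths use the edge to the root of `T`, which the doubled weight on the right covers
  -- exactly.
  ... | yes u∈T | yes v∈T =
    linear (d u v ∷ d x (root T) ∷ treeDist T u ∷ treeDist T v ∷ weight T
             ∷ branchWeight x Ts ∷ [])
      (λ { (uv ∷ e ∷ tu ∷ tv ∷ w ∷ b ∷ []) →
           1 ⊛ uv ⊕ (tu ⊕ tv) ≼ 2 ⊗ w , 2 ⊛ id ≼ b , none
           ⊢ uv ⊕ ((e ⊕ tu) ⊕ (e ⊕ tv)) ≼ 2 ⊗ ((e ⊕ w) ⊕ b) })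
      (tripod T u∈T v∈T ∷ branchWeight-nonNegative x Ts ∷ [])
  ... | no u∉T | no v∉T =
    linear (d u v ∷ d x (root T) ∷ branchDist x Ts u ∷ branchDist x Ts v ∷ weight T
             ∷ branchWeight x Ts ∷ [])
      (λ { (uv ∷ e ∷ tu ∷ tv ∷ w ∷ b ∷ []) →
           1 ⊛ uv ⊕ (tu ⊕ tv) ≼ 2 ⊗ b , 2 ⊛ id ≼ e , 2 ⊛ id ≼ w , none
           ⊢ uv ⊕ (tu ⊕ tv) ≼ 2 ⊗ ((e ⊕ w) ⊕ b) })
      (branchTripod x Ts (∈-otherBranches x T Ts u∉T u∈) (∈-otherBranches x T Ts v∉T v∈)
        ∷ d-nonNegative ∷ weight-nonNegative T ∷ [])
  ... | yes u∈T | no v∉T = distinctBranches x T Ts u∈T (∈-otherBranches x T Ts v∉T v∈)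
  ... | no u∉T | yes v∈T =
    linear (d u v ∷ d v u ∷ branchDist x Ts u ∷ d x (root T) + treeDist T v
             ∷ d x (root T) + weight T + branchWeight x Ts ∷ [])
      (λ { (uv ∷ vu ∷ tu ∷ tv ∷ w ∷ []) →
           1 ⊛ uv ≼ vu , 1 ⊛ vu ⊕ (tv ⊕ tu) ≼ 2 ⊗ w , none ⊢ uv ⊕ (tu ⊕ tv) ≼ 2 ⊗ w })
      (d-comm u v ∷ distinctBranches x T Ts v∈T (∈-otherBranches x T Ts u∉T u∈) ∷ [])

  -- Each edge is walked down and back. The continuation `ys` is carried along so that the induction
  -- passes through the concatenations in `closedWalk` and `openBranches`.
  pathLength-excursions : ∀ x Ts ys →
    pathLength (x ∷ excursions x Ts ++ ys) ≤ 2 · branchWeight x Ts + pathLength (x ∷ ys)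
  pathLength-closedWalk : ∀ x T ys →
    pathLength (x ∷ closedWalk T ++ ys) ≤
    d x (root T) + (2 · weight T + pathLength (root T ∷ ys))
  pathLength-closedWalk x (node y Ts) ys = +-monoʳ-≤ (d x y) (pathLength-excursions y Ts ys)
  pathLength-excursions x []       ys =
    linear (pathLength (x ∷ ys) ∷ []) (λ { (l ∷ []) → none ⊢ l ≼ 2 ⊗ id ⊕ l }) []
  pathLength-excursions x (T ∷ Ts) ys
    rewrite ++-assoc (closedWalk T) (x ∷ excursions x Ts) ys =
    linear (d x (root T) ∷ d (root T) x
             ∷ pathLength (x ∷ closedWalk T ++ x ∷ excursions x Ts ++ ys)
             ∷ weight T ∷ branchWeight x Ts
             ∷ pathLength (x ∷ excursions x Ts ++ ys) ∷ pathLength (x ∷ ys) ∷ [])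
      (λ { (e ∷ e′ ∷ l ∷ w ∷ b ∷ l₁ ∷ l₂ ∷ []) →
           1 ⊛ e′ ≼ e , 1 ⊛ l ≼ e ⊕ (2 ⊗ w ⊕ (e′ ⊕ l₁)) , 1 ⊛ l₁ ≼ 2 ⊗ b ⊕ l₂ , none
           ⊢ l ≼ 2 ⊗ ((e ⊕ w) ⊕ b) ⊕ l₂ })
      (d-comm (root T) x ∷ pathLength-closedWalk x T (x ∷ excursions x Ts ++ ys)
        ∷ pathLength-excursions x Ts ys ∷ [])

  pathLength-openWalk : ∀ x T v →
    pathLength (x ∷ toList (openWalk T v)) ≤ d x (root T) + len (openWalk T v)
  pathLength-openWalk x (node y Ts) v = ≤-refl

  -- Edges on the tree path to `v` are walked once and all others twice, so the depth of `v` is what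
  -- the walk saves over a closed tour.
  len-openWalk : ∀ T v → len (openWalk T v) + treeDist T v ≤ 2 · weight T
  pathLength-openBranches : ∀ x Ts v →
    pathLength (x ∷ openBranches x Ts v) + branchDist x Ts v ≤ 2 · branchWeight x Ts
  len-openWalk (node x Ts) = pathLength-openBranches x Ts
  pathLength-openBranches x []       v =
    linear [] (λ { [] → none ⊢ id ⊕ id ≼ 2 ⊗ id }) []
  pathLength-openBranches x (T ∷ Ts) v with v ∈? vertices T
  ... | yes _ =
    linear (d x (root T) ∷ pathLength (x ∷ excursions x Ts ++ toList (openWalk T v))
             ∷ pathLength (x ∷ toList (openWalk T v)) ∷ len (openWalk T v)
             ∷ treeDist T v ∷ weight T ∷ branchWeight x Ts ∷ [])
      (λ { (e ∷ l ∷ l₁ ∷ l₂ ∷ t ∷ w ∷ b ∷ []) →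
           1 ⊛ l ≼ 2 ⊗ b ⊕ l₁ , 1 ⊛ l₁ ≼ e ⊕ l₂ , 1 ⊛ l₂ ⊕ t ≼ 2 ⊗ w , none
           ⊢ l ⊕ (e ⊕ t) ≼ 2 ⊗ ((e ⊕ w) ⊕ b) })
      (pathLength-excursions x Ts (toList (openWalk T v)) ∷ pathLength-openWalk x T v
        ∷ len-openWalk T v ∷ [])
  ... | no _ =
    linear (d x (root T) ∷ d (root T) x
             ∷ pathLength (x ∷ closedWalk T ++ x ∷ openBranches x Ts v)
             ∷ pathLength (x ∷ openBranches x Ts v)
             ∷ branchDist x Ts v ∷ weight T ∷ branchWeight x Ts ∷ [])
      (λ { (e ∷ e′ ∷ l ∷ l₁ ∷ t ∷ w ∷ b ∷ []) →
           1 ⊛ e′ ≼ e , 1 ⊛ l ≼ e ⊕ (2 ⊗ w ⊕ (e′ ⊕ l₁)) , 1 ⊛ l₁ ⊕ t ≼ 2 ⊗ b , none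
           ⊢ l ⊕ t ≼ 2 ⊗ ((e ⊕ w) ⊕ b) })
      (d-comm (root T) x ∷ pathLength-closedWalk x T (x ∷ openBranches x Ts v)
        ∷ pathLength-openBranches x Ts v ∷ [])

-- Offline cost remaining after a given time.

module OfflineResidual {c ℓ₁ ℓ₂} (K : OrderedField c ℓ₁ ℓ₂) (M : FiniteMetricSpace K)
                       (I : Online.Input K M) where

  open OrderedField K hiding (refl)
  open OrderedFieldProperties K
  open FiniteMetricSpace M
  open MetricProperties K M
  open Online K M
  open Input I
  open Extrema totalOrder using (max≤v⁺; ⊥≤max; xs≤max)
  open Max totalOrder using (maxOperator) renaming (_⊔_ to _⊔ᴷ_)
  open Min totalOrder using (minOperator; _⊓_; x⊓y≤x; x⊓y≤y)
  open MinMaxOp minOperator maxOperator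
    using (x≤x⊔y; x≤y⊔x; ⊔-lub; ⊓-glb; ⊔-monoʳ-≤; ⊓-monoˡ-≤)

  maxDelay-upper : ∀ {t v} B → 0# ≤ v → (∀ {q} → q ∈ B → t - arrival q ≤ v) →
                   maxDelay I t B ≤ v
  maxDelay-upper []      0≤v _  = 0≤v
  maxDelay-upper (q ∷ B) _ ≤v =
    max≤v⁺ (≤v (here refl)) (All.tabulate λ x∈ → helper (∈-map⁻ _ x∈))
    where
    helper : ∀ {x} → ∃ (λ r → r ∈ B × x ≡ _ - arrival r) → x ≤ _
    helper (_ , r∈B , refl) = ≤v (there r∈B)

  delay≤maxDelay : ∀ {t q} B → q ∈ B → t - arrival q ≤ maxDelay I t B
  delay≤maxDelay {t} (q ∷ B) (here refl) = ⊥≤max (t - arrival q) (map (λ r → t - arrival r) B)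
  delay≤maxDelay {t} (q ∷ B) (there r∈B) =
    All.lookup (xs≤max (t - arrival q) _) (∈-map⁺ (λ r → t - arrival r) r∈B)

  maxDelay-nonNegative : ∀ {t} B → All (λ q → arrival q ≤ t) B → 0# ≤ maxDelay I t B
  maxDelay-nonNegative []      _         = ≤-refl
  maxDelay-nonNegative (q ∷ B) (a≤t ∷ _) =
    ≤-trans (x≤y⇒0≤y-x a≤t) (delay≤maxDelay (q ∷ B) (here refl))

  -- The part of the delay cost of a service event that accrues after time θ; the
  -- outer maximum matters for events before θ, where t - θ is negative.
  delayAfter : Carrier → Carrier × Service I → Carrier
  delayAfter θ (t , _ serving B) = 0# ⊔ᴷ ((t - θ) ⊓ maxDelay I t B)

  residual : Carrier → List (Carrier × Service I) → Carrier
  residual θ []       = 0#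
  residual θ (v ∷ vs) = (len (Service.walk (proj₂ v)) + delayAfter θ v) + residual θ vs

  delayAfter-antitone : ∀ {θ τ} → θ ≤ τ → ∀ v → delayAfter τ v ≤ delayAfter θ v
  delayAfter-antitone {θ} {τ} θ≤τ (t , _ serving B) =
    ⊔-monoʳ-≤ 0# (⊓-monoˡ-≤ (maxDelay I t B)
      (linear (t ∷ θ ∷ τ ∷ - θ ∷ - τ ∷ [])
        (λ { (t ∷ θ ∷ τ ∷ -θ ∷ -τ ∷ []) →
             1 ⊛ θ ≼ τ , 1 ⊛ τ ⊕ -τ ≼ id , 1 ⊛ id ≼ θ ⊕ -θ , none ⊢ t ⊕ -τ ≼ t ⊕ -θ })
        (θ≤τ ∷ x-x≤0 τ ∷ 0≤x-x θ ∷ [])))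

  residual-nonNegative : ∀ θ vs → 0# ≤ residual θ vs
  residual-nonNegative θ []       = ≤-refl
  residual-nonNegative θ (v@(t , w serving B) ∷ vs) =
    linear (len w ∷ delayAfter θ v ∷ residual θ vs ∷ [])
      (λ { (l ∷ e ∷ r ∷ []) →
           1 ⊛ id ≼ l , 1 ⊛ id ≼ e , 1 ⊛ id ≼ r , none ⊢ id ≼ (l ⊕ e) ⊕ r })
      (pathLength-nonNegative (toList w) ∷ x≤x⊔y 0# _ ∷ residual-nonNegative θ vs ∷ [])

  residual-antitone : ∀ {θ τ} → θ ≤ τ → ∀ vs → residual τ vs ≤ residual θ vs
  residual-antitone θ≤τ []       = ≤-refl
  residual-antitone θ≤τ (v ∷ vs) =
    +-monoʳ-≤ _ (delayAfter-antitone θ≤τ v) ⊞ residual-antitone θ≤τ vs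

  -- A request that arrived after θ and is served at t ≥ τ has its whole delay t - a counted from θ.
  -- This splits as (τ - a) + (t - τ), and t - τ is all that can still be counted from τ.
  delayAfter-pending : ∀ {θ τ q} v → θ ≤ arrival q → τ ≤ proj₁ v →
    q ∈ Service.batch (proj₂ v) → (τ - arrival q) + delayAfter τ v ≤ delayAfter θ v
  delayAfter-pending {θ} {τ} {q} v@(t , _ serving B) θ≤a τ≤t q∈B =
    linear (t ∷ τ ∷ - τ ∷ - arrival q ∷ delayAfter τ v ∷ delayAfter θ v ∷ [])
      (λ { (t ∷ τ ∷ -τ ∷ -a ∷ e ∷ e′ ∷ []) →
           1 ⊛ e ≼ t ⊕ -τ , 1 ⊛ τ ⊕ -τ ≼ id , 1 ⊛ t ⊕ -a ≼ e′ , none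
           ⊢ (τ ⊕ -a) ⊕ e ≼ e′ })
      (⊔-lub (x≤y⇒0≤y-x τ≤t) (x⊓y≤x _ _) ∷ x-x≤0 τ ∷ t-a≤ ∷ [])
    where
    t-a≤ : t - arrival q ≤ delayAfter θ v
    t-a≤ = ≤-trans (⊓-glb
      (linear (t ∷ θ ∷ arrival q ∷ - θ ∷ - arrival q ∷ [])
        (λ { (t ∷ θ ∷ a ∷ -θ ∷ -a ∷ []) →
             1 ⊛ θ ≼ a , 1 ⊛ a ⊕ -a ≼ id , 1 ⊛ id ≼ θ ⊕ -θ , none ⊢ t ⊕ -a ≼ t ⊕ -θ })
        (θ≤a ∷ x-x≤0 (arrival q) ∷ 0≤x-x θ ∷ []))
      (delay≤maxDelay B q∈B)) (x≤y⊔x 0# _)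

  Serves : Request I → Carrier × Service I → Set
  Serves q v = q ∈ Service.batch (proj₂ v)

  served-or-pending : ∀ {o served vs} → Execution I o served vs →
                      ∀ q → q ∈ served ⊎ Any (Serves q) vs
  served-or-pending (finished all) q = inj₁ (all q)
  served-or-pending (perform {B = B} _ _ ex) q with served-or-pending ex q
  ... | inj₂ later = inj₂ (there later)
  ... | inj₁ q∈ with ∈-++⁻ B q∈
  ...   | inj₁ q∈B      = inj₂ (here q∈B)
  ...   | inj₂ q∈served = inj₁ q∈served

  residual-pending : ∀ {θ τ q vs} → θ ≤ arrival q → θ ≤ τ → All (λ v → τ ≤ proj₁ v) vs →
    Any (Serves q) vs → (τ - arrival q) + residual τ vs ≤ residual θ vs
  residual-pending {θ} {τ} {q} {v ∷ vs} θ≤a θ≤τ (τ≤t ∷ _) (here q∈B) =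
    linear (len w ∷ τ - arrival q ∷ delayAfter τ v ∷ delayAfter θ v
             ∷ residual τ vs ∷ residual θ vs ∷ [])
      (λ { (l ∷ D ∷ e ∷ e′ ∷ r ∷ r′ ∷ []) →
           1 ⊛ D ⊕ e ≼ e′ , 1 ⊛ r ≼ r′ , none ⊢ D ⊕ ((l ⊕ e) ⊕ r) ≼ (l ⊕ e′) ⊕ r′ })
      (delayAfter-pending v θ≤a τ≤t q∈B ∷ residual-antitone θ≤τ vs ∷ [])
    where w = Service.walk (proj₂ v)
  residual-pending {θ} {τ} {q} {v ∷ vs} θ≤a θ≤τ (_ ∷ later) (there pending) =
    linear (len w ∷ τ - arrival q ∷ delayAfter τ v ∷ delayAfter θ v
             ∷ residual τ vs ∷ residual θ vs ∷ [])
      (λ { (l ∷ D ∷ e ∷ e′ ∷ r ∷ r′ ∷ []) →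
           1 ⊛ e ≼ e′ , 1 ⊛ D ⊕ r ≼ r′ , none ⊢ D ⊕ ((l ⊕ e) ⊕ r) ≼ (l ⊕ e′) ⊕ r′ })
      (delayAfter-antitone θ≤τ v ∷ residual-pending θ≤a θ≤τ later pending ∷ [])
    where w = Service.walk (proj₂ v)

  -- `D` is the largest of 0 and the delays at τ of the pending requests in `Q`. Only one request
  -- attaining it is charged, so events that serve many requests are not charged repeatedly.
  maximumPendingDelay : ∀ {θ τ o served vs} → θ ≤ τ → Execution I o served vs →
    All (λ v → τ ≤ proj₁ v) vs → ∀ Q → (∀ {q} → q ∈ Q → θ ≤ arrival q) →
    ∃ λ D → 0# ≤ D × D + residual τ vs ≤ residual θ vs ×
            (∀ {q} → q ∈ Q → q ∈ served ⊎ τ ≤ arrival q + D)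
  maximumPendingDelay {θ} {τ} {vs = vs} θ≤τ ex later [] θ≤ =
    0# , ≤-refl ,
    linear (residual τ vs ∷ residual θ vs ∷ [])
      (λ { (r ∷ r′ ∷ []) → 1 ⊛ r ≼ r′ , none ⊢ id ⊕ r ≼ r′ })
      (residual-antitone θ≤τ vs ∷ []) ,
    λ ()
  maximumPendingDelay {θ} {τ} {served = served} θ≤τ ex later (q ∷ Q) θ≤
    with maximumPendingDelay θ≤τ ex later Q (λ q∈ → θ≤ (there q∈)) | served-or-pending ex q
  ... | D , 0≤D , D≤ , bound | inj₁ q∈served = D , 0≤D , D≤ , λ where
    (here refl) → inj₁ q∈served
    (there r∈Q) → bound r∈Q
  ... | D , 0≤D , D≤ , bound | inj₂ pending with total (τ - arrival q) D
  ...   | inj₁ delay≤D = D , 0≤D , D≤ , λ where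
    (here refl) → inj₂ (x-y≤z⇒x≤y+z delay≤D)
    (there r∈Q) → bound r∈Q
  ...   | inj₂ D≤delay = τ - arrival q , ≤-trans 0≤D D≤delay ,
    residual-pending (θ≤ (here refl)) θ≤τ later pending , λ where
    (here refl) → inj₂ (x-y≤z⇒x≤y+z ≤-refl)
    (there r∈Q) → map₂ (λ τ≤ → ≤-trans τ≤ (+-monoʳ-≤ _ D≤delay)) (bound r∈Q)

  -- The offline events at times up to and including τ are fused into one path from `o`. In
  -- `length≤` their delay is dropped, while that of `rest` is still measured from θ, so that it can
  -- be released separately.
  record SplitAt (τ θ : Carrier) (o : Point) (served : List (Request I))
                 (vs : List (Carrier × Service I)) : Set (c ⊔ ℓ₂) where
    field
      path      : List Point
      served′   : List (Request I)
      rest      : List (Carrier × Service I)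
      execution : Execution I (last (o ∷ path)) served′ rest
      sorted    : AllPairs (_≤_ on proj₁) rest
      later     : All (λ v → τ ≤ proj₁ v) rest
      newly     : ∀ {q} → q ∈ served′ →
                  q ∈ served ⊎ (arrival q ≤ τ × location q ∈ o ∷ path)
      length≤   : pathLength (o ∷ path) + residual θ rest ≤ residual θ vs

  splitAt : ∀ τ θ {o served vs} → Execution I o served vs →
            AllPairs (_≤_ on proj₁) vs → SplitAt τ θ o served vs
  splitAt τ θ {served = served} ex@(finished _) [] = record
    { path = [] ; served′ = served ; rest = [] ; execution = ex ; sorted = [] ; later = []
    ; newly = inj₁
    ; length≤ = linear [] (λ { [] → none ⊢ id ⊕ id ≼ id }) [] }
  splitAt τ θ {served = served} {vs}
    ex@(perform {t = t} {w = x ∷ ws} {B} {vs′} refl servable ex′) (t≤ ∷ srt)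
    with t ≤? τ
  ... | no t≰τ = record
    { path = [] ; served′ = served ; rest = vs ; execution = ex ; sorted = t≤ ∷ srt
    ; later = τ≤t ∷ All.map (≤-trans τ≤t) t≤
    ; newly = inj₁
    ; length≤ = linear (residual θ vs ∷ []) (λ { (r ∷ []) → none ⊢ id ⊕ r ≼ r }) [] }
    where τ≤t = ≰⇒≥ t≰τ
  ... | yes t≤τ = record
    { path = ws ++ path ; served′ = served′ ; rest = rest
    ; execution = subst (λ y → Execution I y served′ rest) (≡.sym (last-++ x ws path)) execution
    ; sorted = sorted ; later = later
    ; newly = λ q∈ → newly′ (newly q∈)
    ; length≤ =
        linear (pathLength (x ∷ ws ++ path) ∷ pathLength (x ∷ ws)
                 ∷ pathLength (last (x ∷ ws) ∷ path)
                 ∷ delayAfter θ v ∷ residual θ rest ∷ residual θ vs′ ∷ [])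
          (λ { (l ∷ l₁ ∷ l₂ ∷ e ∷ r ∷ r′ ∷ []) →
               1 ⊛ l ≼ l₁ ⊕ l₂ , 1 ⊛ id ≼ e , 1 ⊛ l₂ ⊕ r ≼ r′ , none
               ⊢ l ⊕ r ≼ (l₁ ⊕ e) ⊕ r′ })
          (pathLength-++ x ws path ∷ x≤x⊔y 0# _ ∷ length≤ ∷ []) }
    where
    v = t , (x ∷ ws) serving B
    open SplitAt (splitAt τ θ ex′ srt)
    last-∈ : ∀ (y : Point) ys → last (y ∷ ys) ∈ y ∷ ys
    last-∈ y []       = here refl
    last-∈ y (z ∷ zs) rewrite last-∷ y z zs = there (last-∈ z zs)
    visited : ∀ {y} → y ∈ last (x ∷ ws) ∷ path → y ∈ x ∷ ws ++ path
    visited (here refl) = ∈-++⁺ˡ (last-∈ x ws)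
    visited (there y∈)  = ∈-++⁺ʳ (x ∷ ws) y∈
    newly′ : ∀ {q} → q ∈ B ++ served ⊎ (arrival q ≤ τ × location q ∈ last (x ∷ ws) ∷ path) →
             q ∈ served ⊎ (arrival q ≤ τ × location q ∈ x ∷ ws ++ path)
    newly′ (inj₂ (a≤τ , y∈)) = inj₂ (a≤τ , visited y∈)
    newly′ (inj₁ q∈) with ∈-++⁻ B q∈
    ... | inj₂ q∈served = inj₁ q∈served
    ... | inj₁ q∈B with All.lookup servable q∈B
    ...   | a≤t , _ , y∈ = inj₂ (≤-trans a≤t t≤τ , ∈-++⁺ˡ y∈)

  residual≤cost : ∀ θ {o served vs} → Execution I o served vs →
                  residual θ vs ≤ sum (map (serviceCost I) vs)
  residual≤cost θ (finished _) = ≤-refl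
  residual≤cost θ (perform {B = B} _ servable ex) =
    -- The outer maximum in `delayAfter` adds nothing here: no request is served before it arrives.
    +-monoʳ-≤ _ (⊔-lub 0≤delay (x⊓y≤y _ _)) ⊞ residual≤cost θ ex
    where 0≤delay = maxDelay-nonNegative B (All.map proj₁ servable)

-- The potential argument.

module CompetitiveAnalysis {c ℓ₁ ℓ₂} (K : OrderedField c ℓ₁ ℓ₂) (M : FiniteMetricSpace K)
  (I : Online.Input K M) (oracle : Online.SteinerOracle K M)
  (rule : Online.FarthestRule K M I) where

  open OrderedField K hiding (refl)
  open OrderedFieldProperties K
  open FiniteMetricSpace M
  open Online K M
  open MetricProperties K M
  open OfflineResidual K M I
  open Input I
  open SteinerOracle oracle
  open FarthestRule rule
  open Algorithm I oracle rule
  open Max totalOrder using (x≤y⊔x; ⊔-lub)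
  open Sort decTotalOrder using (sort; sort-↭; sort-↗)

  -- θ is the last trigger time, and the execution is what remains of an offline
  -- schedule whose server is at o after its actions up to time θ.
  record Dominated (θ : Carrier) (s : Point) (σ : Schedule I) : Set (c ⊔ ℓ₂) where
    field
      cost≤ : ∀ {o served vs} → Execution I o served vs → AllPairs (_≤_ on proj₁) vs →
              (∀ {q} → q ∈ served → arrival q ≤ θ) →
              cost I σ ≤ 12 · residual θ vs + 2 · d s o
  open Dominated

  -- The invariant of an active phase whose latest processed epoch is at `t`. The strictness in
  -- `θ<α` keeps its requests apart from those served offline by time θ.
  record Phase (θ : Carrier) (s : Point) (α : Carrier) (P : List⁺ (Request I))
               (t : Carrier) : Set (c ⊔ ℓ₂) where
    field
      θ<α         : ¬ (α ≤ θ)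
      first       : arrival (head P) ≤ α
      α≤arrival   : ∀ {q} → q ∈ toList P → α ≤ arrival q
      arrival≤t   : ∀ {q} → q ∈ toList P → arrival q ≤ t
      untriggered : t ≤ α + weight (steinerTree s P)
      -- The requests that arrived before u already force a Steiner cost of u - α.
      growth      : ∀ u T → u ≤ α + weight (steinerTree s P) → IsTree T → s ∈ vertices T →
                    (∀ {q} → q ∈ toList P → ¬ (u ≤ arrival q) → location q ∈ vertices T) →
                    u ≤ α + weight T

  steiner-minimal : ∀ s P T → IsTree T → s ∈ vertices T →
    (∀ {q} → q ∈ toList P → location q ∈ vertices T) → weight (steinerTree s P) ≤ weight T
  steiner-minimal s P T isTree s∈T P⊆T =
    IsSteinerTree.minimal (optimal s (map location (toList P))) T isTree spans
    where
    spans : s ∷ map location (toList P) ⊆ vertices T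
    spans (here refl) = s∈T
    spans (there x∈) with ∈-map⁻ location x∈
    ... | _ , q∈P , refl = P⊆T q∈P

  s∈steinerTree : ∀ s P → s ∈ vertices (steinerTree s P)
  s∈steinerTree s P = IsSteinerTree.spans (optimal s (map location (toList P))) (here refl)

  ∈-steinerTree : ∀ s P {q} → q ∈ toList P → location q ∈ vertices (steinerTree s P)
  ∈-steinerTree s P q∈P =
    IsSteinerTree.spans (optimal s (map location (toList P))) (there (∈-map⁺ location q∈P))

  d≤treeDist-steiner : ∀ s P {q} → q ∈ toList P →
    d s (location q) ≤ treeDist (steinerTree s P) (location q)
  d≤treeDist-steiner s P {q} q∈P =
    subst (λ r → d r (location q) ≤ treeDist (steinerTree s P) (location q))
      (rooted s (map location (toList P))) (d≤treeDist (steinerTree s P) (∈-steinerTree s P q∈P))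

  arrival-epoch : ∀ {t q} → q ∈ epoch t → arrival q ≈ t
  arrival-epoch {t} q∈ = proj₂ (∈-filter⁻ (λ q → arrival q ≟ t) {xs = allFin #requests} q∈)

  arrival-away : ∀ {s t q} → q ∈ awayFromAnchor s t → arrival q ≈ t
  arrival-away {s} {t} q∈ =
    arrival-epoch (proj₁ (∈-filter⁻ (λ q → ¬? (location q ≟ᵖ s)) {xs = epoch t} q∈))

  phase-start : ∀ {θ s t q P} → ¬ (t ≤ θ) → (∀ {r} → r ∈ q ∷ P → arrival r ≈ t) →
                Phase θ s t (q ∷ P) t
  phase-start {θ} {s} {t} {q} {P} θ<t now = record
    { θ<α = θ<t
    ; first = ≤-reflexive (now (here refl))
    ; α≤arrival = λ r∈ → ≤-reflexive (sym (now r∈))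
    ; arrival≤t = λ r∈ → ≤-reflexive (now r∈)
    ; untriggered = x≤x+y t (weight-nonNegative F)
    ; growth = growth }
    where
    F = steinerTree s (q ∷ P)
    growth : ∀ u T → u ≤ t + weight F → IsTree T → s ∈ vertices T →
             (∀ {r} → r ∈ q ∷ P → ¬ (u ≤ arrival r) → location r ∈ vertices T) →
             u ≤ t + weight T
    growth u T u≤ isTree s∈T early with u ≤? t
    ... | yes u≤t = ≤-trans u≤t (x≤x+y t (weight-nonNegative T))
    ... | no  u≰t = ≤-trans u≤ (+-monoʳ-≤ t (steiner-minimal s (q ∷ P) T isTree s∈T
            λ r∈ → early r∈ λ u≤a → u≰t (≤-trans u≤a (≤-reflexive (now r∈)))))

  -- The new Steiner tree is a candidate for the old terminals, so arrivals cannot lower the Steiner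
  -- cost and the test cannot come to have succeeded before `t′`.
  phase-extend : ∀ {θ s α P t t′ Q} → Phase θ s α P t → t ≤ t′ →
    t′ ≤ α + weight (steinerTree s P) → (∀ {r} → r ∈ Q → arrival r ≈ t′) →
    Phase θ s α (P ⁺++ Q) t′
  phase-extend {θ} {s} {α} {P} {t} {t′} {Q} phase t≤t′ t′≤ now = record
    { θ<α = θ<α
    ; first = first
    ; α≤arrival = λ r∈ → α≤arrival′ (∈-++⁻ (toList P) r∈)
    ; arrival≤t = arrival≤t′
    ; untriggered = ≤-trans t′≤ (+-monoʳ-≤ α (steiner-minimal s P F′ isTree′ (s∈steinerTree s P′)
        λ r∈ → ∈-steinerTree s P′ (old r∈)))
    ; growth = growth′ }
    where
    open Phase phase
    P′ = P ⁺++ Q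
    F′ = steinerTree s P′
    isTree′ = IsSteinerTree.isTree (optimal s (map location (toList P′)))
    old : toList P ⊆ toList P′
    old = ∈-++⁺ˡ
    α≤arrival′ : ∀ {r} → r ∈ toList P ⊎ r ∈ Q → α ≤ arrival r
    α≤arrival′ (inj₁ r∈P) = α≤arrival r∈P
    α≤arrival′ (inj₂ r∈Q) =
      ≤-trans (α≤arrival (here refl)) (≤-trans (arrival≤t (here refl))
        (≤-trans t≤t′ (≤-reflexive (sym (now r∈Q)))))
    arrival≤t′ : ∀ {r} → r ∈ toList P′ → arrival r ≤ t′
    arrival≤t′ r∈ with ∈-++⁻ (toList P) r∈
    ... | inj₁ r∈P = ≤-trans (arrival≤t r∈P) t≤t′
    ... | inj₂ r∈Q = ≤-reflexive (now r∈Q)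
    growth′ : ∀ u T → u ≤ α + weight F′ → IsTree T → s ∈ vertices T →
              (∀ {q} → q ∈ toList P′ → ¬ (u ≤ arrival q) → location q ∈ vertices T) →
              u ≤ α + weight T
    growth′ u T u≤ isTree s∈T early with u ≤? t′
    -- Epoch `t′` came no later than the old trigger, so the old bound covers `u`; requests in `Q`
    -- are not earlier than `u` and need not be spanned.
    ... | yes u≤t′ = growth u T (≤-trans u≤t′ t′≤) isTree s∈T (λ q∈ → early (old q∈))
    ... | no  u≰t′ = ≤-trans u≤ (+-monoʳ-≤ α (steiner-minimal s P′ T isTree s∈T
            λ q∈ → early q∈ λ u≤a → u≰t′ (≤-trans u≤a (arrival≤t′ q∈))))

  []-dominated : ∀ {θ s} → Dominated θ s []
  []-dominated {θ} {s} .cost≤ {o} {vs = vs} _ _ _ =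
    linear (residual θ vs ∷ d s o ∷ [])
      (λ { (R ∷ x ∷ []) → 12 ⊛ id ≼ R , 2 ⊛ id ≼ x , none ⊢ id ≼ 12 ⊗ R ⊕ 2 ⊗ x })
      (residual-nonNegative θ vs ∷ d-nonNegative ∷ [])

  serveAtAnchor-dominated : ∀ {θ s} t {σ} → Dominated θ s σ → Dominated θ s (serveAtAnchor s t ∷ σ)
  serveAtAnchor-dominated {θ} {s} t {σ} dom .cost≤ {o} {vs = vs} ex srt served≤ =
    linear (maxDelay I t (atAnchor s t) ∷ cost I σ ∷ 12 · residual θ vs + 2 · d s o ∷ [])
      (λ { (m ∷ l ∷ r ∷ []) → 1 ⊛ m ≼ id , 1 ⊛ l ≼ r , none ⊢ (id ⊕ m) ⊕ l ≼ r })
      (maxDelay-upper (atAnchor s t) ≤-refl noDelay ∷ dom .cost≤ ex srt served≤ ∷ [])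
    where
    noDelay : ∀ {q} → q ∈ atAnchor s t → t - arrival q ≤ 0#
    noDelay {q} q∈ = linear (t ∷ arrival q ∷ - arrival q ∷ [])
      (λ { (t ∷ a ∷ -a ∷ []) → 1 ⊛ t ≼ a , 1 ⊛ a ⊕ -a ≼ id , none ⊢ t ⊕ -a ≼ id })
      (≤-reflexive (sym (arrival-epoch (proj₁ (∈-filter⁻ (λ q → location q ≟ᵖ s) {xs = epoch t} q∈))))
        ∷ x-x≤0 (arrival q) ∷ [])

  -- Amortised cost of one phase.

  module _ {θ s α P t} (phase : Phase θ s α P t) where

    open Phase phase

    private
      F  = steinerTree s P
      S  = weight F
      s′ = nextAnchor s P
      τ  = trigger s α P t
      W  = len (openWalk F s′)
      q₀ = head P

    -- Together with `≤trigger` this says τ = α + S: by `untriggered` the maximum in `trigger` is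
    -- never attained by `t` alone.
    trigger≤ : τ ≤ α + S
    trigger≤ = ⊔-lub untriggered ≤-refl

    ≤trigger : α + S ≤ τ
    ≤trigger = x≤y⊔x t (α + S)

    α≤τ : α ≤ τ
    α≤τ = ≤-trans (x≤x+y α (weight-nonNegative F)) ≤trigger

    endPhase-delay : maxDelay I τ (toList P) ≤ S
    endPhase-delay = maxDelay-upper (toList P) (weight-nonNegative F) λ {q} q∈ →
      linear (τ ∷ α ∷ S ∷ arrival q ∷ - arrival q ∷ [])
        (λ { (τ ∷ α ∷ S ∷ a ∷ -a ∷ []) →
             1 ⊛ τ ≼ α ⊕ S , 1 ⊛ α ≼ a , 1 ⊛ a ⊕ -a ≼ id , none ⊢ τ ⊕ -a ≼ S })
        (trigger≤ ∷ α≤arrival q∈ ∷ x-x≤0 (arrival q) ∷ [])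

    module _ {o served vs} (split : SplitAt τ θ o served vs)
             (served≤θ : ∀ {q} → q ∈ served → arrival q ≤ θ)
             {D} (0≤D : 0# ≤ D)
             (servedOrLate : ∀ {q} → q ∈ toList P →
                             q ∈ SplitAt.served′ split ⊎ τ ≤ arrival q + D) where

      open SplitAt split

      private
        o′   = last (o ∷ path)
        len₀ = pathLength (o ∷ path)
        x    = d s o
        y    = d s′ o′

      visited : ∀ {q} → q ∈ toList P → q ∈ served′ → location q ∈ o ∷ path
      visited q∈P q∈ with newly q∈
      -- Anything served before the split arrived by θ, too early for this phase.
      ... | inj₁ q∈served = contradiction (≤-trans (α≤arrival q∈P) (served≤θ q∈served)) θ<α
      ... | inj₂ (_ , x∈) = x∈

      -- `growth` is applied at u = τ - D to a tree through `s` and the offline path. A request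
      -- arriving before u is not pending offline, since its delay would exceed `D`; hence the path
      -- visits it.
      S≤ : S ≤ x + (len₀ + D)
      S≤ with spanningTree s (o ∷ path)
      ... | T , isTree , spans , weight≤ =
        linear (S ∷ x ∷ len₀ ∷ D ∷ τ ∷ - D ∷ α ∷ weight T ∷ [])
          (λ { (S ∷ x ∷ l ∷ D ∷ τ ∷ -D ∷ α ∷ w ∷ []) →
               1 ⊛ α ⊕ S ≼ τ , 1 ⊛ τ ⊕ -D ≼ α ⊕ w , 1 ⊛ w ≼ x ⊕ l , 1 ⊛ id ≼ D ⊕ -D , none
               ⊢ S ≼ x ⊕ (l ⊕ D) })
          (≤trigger ∷ growth (τ - D) T τ-D≤ isTree (spans (here refl)) early ∷ weight≤ ∷ 0≤x-x D ∷ [])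
        where
        τ-D≤ : τ - D ≤ α + S
        τ-D≤ = linear (τ ∷ D ∷ - D ∷ α + S ∷ [])
          (λ { (τ ∷ D ∷ -D ∷ r ∷ []) →
               1 ⊛ τ ≼ r , 1 ⊛ id ≼ D , 1 ⊛ D ⊕ -D ≼ id , none ⊢ τ ⊕ -D ≼ r })
          (trigger≤ ∷ 0≤D ∷ x-x≤0 D ∷ [])
        early : ∀ {q} → q ∈ toList P → ¬ (τ - D ≤ arrival q) → location q ∈ vertices T
        early {q} q∈P a<τ-D with servedOrLate q∈P
        ... | inj₁ q∈served′ = spans (there (visited q∈P q∈served′))
        ... | inj₂ τ≤a+D = contradiction
          (linear (τ ∷ D ∷ - D ∷ arrival q ∷ [])
            (λ { (τ ∷ D ∷ -D ∷ a ∷ []) →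
                 1 ⊛ τ ≼ a ⊕ D , 1 ⊛ D ⊕ -D ≼ id , none ⊢ τ ⊕ -D ≼ a })
            (τ≤a+D ∷ x-x≤0 D ∷ []))
          a<τ-D

      -- The case split is on the first request. If pending, it has waited since α, so `D` is at
      -- least τ - α = S. If served, the offline path passes its location, and `tripod` limits how
      -- far that is from the new anchor.
      amortised : (W + S) + 2 · y ≤ 12 · (len₀ + D) + 2 · x
      amortised with servedOrLate (here refl)
      ... | inj₁ q₀∈served′ =
        amortised-served S≤ (triangle s v₀ o) (d-comm v₀ o) (d≤treeDist-steiner s P q₀∈P)
          (choose-farthest F P q₀∈P)
          (tripod F (∈-steinerTree s P q₀∈P) (∈-steinerTree s P (choose-∈ F P)))
          (d-comm s′ v₀) (triangle s′ v₀ o′)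
          (detour≤pathLength o path (visited q₀∈P q₀∈served′))
          d-nonNegative 0≤D (len-openWalk F s′)
        where
        v₀ = location q₀
        q₀∈P : q₀ ∈ toList P
        q₀∈P = here refl
      ... | inj₂ τ≤a+D =
        amortised-pending S≤D (treeDist≤weight F s′) (triangle s′ s o′) (d-comm s′ s)
          (d≤treeDist-steiner s P (choose-∈ F P)) (triangle s o o′)
          (d-last≤pathLength o path) (len-openWalk F s′)
          (pathLength-nonNegative (o ∷ path)) 0≤D
        where
        S≤D : S ≤ D
        S≤D = linear (S ∷ D ∷ τ ∷ α ∷ arrival q₀ ∷ [])
          (λ { (S ∷ D ∷ τ ∷ α ∷ a ∷ []) →
               1 ⊛ α ⊕ S ≼ τ , 1 ⊛ τ ≼ a ⊕ D , 1 ⊛ a ≼ α , none ⊢ S ≼ D })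
          (≤trigger ∷ τ≤a+D ∷ first ∷ [])

    -- The offline budget is spent in two steps: the split pays for movement at level θ, and raising
    -- the level from θ to τ on the remaining events releases `D`. The rest of the run is bounded by
    -- the residual at τ.
    endPhase-dominated : ∀ {σ} → Dominated τ s′ σ → Dominated θ s (endPhase s P τ ∷ σ)
    endPhase-dominated dom .cost≤ {served = served} ex srt served≤θ
      with splitAt τ θ ex srt
    ... | split with maximumPendingDelay (≤-trans (≰⇒≥ θ<α) α≤τ)
                       (SplitAt.execution split) (SplitAt.later split) (toList P)
                       (λ q∈ → ≤-trans (≰⇒≥ θ<α) (α≤arrival q∈))
    ...   | D , 0≤D , D≤ , servedOrLate =
      amortised-step (amortised split served≤θ 0≤D servedOrLate) endPhase-delay
        (dom .cost≤ execution sorted served′≤τ) length≤ D≤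
      where
      open SplitAt split
      served′≤τ : ∀ {q} → q ∈ served′ → arrival q ≤ τ
      served′≤τ q∈ with newly q∈
      ... | inj₁ q∈served  = ≤-trans (served≤θ q∈served) (≤-trans (≰⇒≥ θ<α) α≤τ)
      ... | inj₂ (a≤τ , _) = a≤τ

  -- Induction along the run of the algorithm.

  idle-dominated : ∀ {θ} s ts → AllPairs _≤_ ts → All (λ t → ¬ (t ≤ θ)) ts →
                   Dominated θ s (idle s ts)
  start-dominated : ∀ {θ} s Q t ts → (∀ {r} → r ∈ Q → arrival r ≈ t) → AllPairs _≤_ (t ∷ ts) →
                    All (λ t → ¬ (t ≤ θ)) (t ∷ ts) → Dominated θ s (start s Q t ts)
  active-dominated : ∀ {θ s α P t} ts → Phase θ s α P t → AllPairs _≤_ (t ∷ ts) →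
                     Dominated θ s (active s α P t ts)

  idle-dominated s []       _   _ = []-dominated
  idle-dominated s (t ∷ ts) srt θ< =
    serveAtAnchor-dominated t (start-dominated s (awayFromAnchor s t) t ts arrival-away srt θ<)

  start-dominated s []      t ts now (_ ∷ srt) (_ ∷ θ<) = idle-dominated s ts srt θ<
  start-dominated s (q ∷ Q) t ts now srt       (θ<t ∷ _) =
    active-dominated ts (phase-start θ<t now) srt

  active-dominated []        phase _ = endPhase-dominated phase []-dominated
  active-dominated {s = s} {α} {P} {t} (t′ ∷ ts) phase ((t≤t′ ∷ _) ∷ srt@(t′≤ ∷ _))
    with t′ ≤? trigger s α P t
  ... | yes t′≤τ = serveAtAnchor-dominated t′
          (active-dominated ts (phase-extend phase t≤t′ (≤-trans t′≤τ (trigger≤ phase)) arrival-away) srt)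
  ... | no  t′≰τ = endPhase-dominated phase
          (serveAtAnchor-dominated t′
            (start-dominated (nextAnchor s P) (awayFromAnchor (nextAnchor s P) t′) t′ ts arrival-away srt
              -- τ becomes the new reference time; by sortedness every remaining epoch lies strictly
              -- after it.
              (t′≰τ ∷ All.map (λ t′≤u u≤τ → t′≰τ (≤-trans t′≤u u≤τ)) t′≤)))

  -- Comparison with offline schedules and the optimum.

  epochTimes-sorted : AllPairs _≤_ epochTimes
  epochTimes-sorted = deduplicate-sorted (Linked⇒AllPairs ≤-trans (sort-↗ (tabulate arrival)))
    where
    deduplicate-sorted : ∀ {ts} → AllPairs _≤_ ts → AllPairs _≤_ (deduplicate _≟_ ts)
    deduplicate-sorted [] = []
    deduplicate-sorted {t ∷ ts} (t≤ ∷ srt) =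
      All.filter⁺ _ (All.deduplicate⁺ _≟_ t≤) ∷ AllPairs.filter⁺ _ (deduplicate-sorted srt)

  epochTimes-nonNegative : All (0# ≤_) epochTimes
  epochTimes-nonNegative = All.deduplicate⁺ _≟_
    (All-resp-↭ (↭-sym (sort-↭ (tabulate arrival))) (All.tabulate⁺ arrival-nonNegative))

  timedServices-sorted : ∀ σ → AllPairs (_≤_ on Action.time) σ →
                         AllPairs (_≤_ on proj₁) (timedServices I σ)
  timedServices-sorted σ srt =
    AllPairs.concat⁺ (All.map⁺ (All.universal sameTime σ)) (AllPairs.map⁺ (AllPairs.map later srt))
    where
    timed : Action I → List (Carrier × Service I)
    timed (t ⟫ ws) = map (t ,_) ws
    sameTime : ∀ a → AllPairs (_≤_ on proj₁) (timed a)
    sameTime (t ⟫ ws) = AllPairs.map⁺ (equalTimes ws)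
      where
      equalTimes : ∀ ws → AllPairs (λ _ _ → t ≤ t) ws
      equalTimes []       = []
      equalTimes (w ∷ ws) = All.universal (λ _ → ≤-refl) ws ∷ equalTimes ws
    later : ∀ {a b} → Action.time a ≤ Action.time b →
            All (λ v → All (λ w → proj₁ v ≤ proj₁ w) (timed b)) (timed a)
    later {_ ⟫ vs} {_ ⟫ ws} a≤b =
      All.map⁺ (All.universal (λ _ → All.map⁺ (All.universal (λ _ → a≤b) ws)) vs)

  ALG≤12cost : ∀ s₀ σ → Feasible I s₀ σ → ALG s₀ ≤ 12 · cost I σ
  ALG≤12cost s₀ σ feasible =
    linear (ALG s₀ ∷ residual θ vs ∷ cost I σ ∷ d s₀ s₀ ∷ [])
      (λ { (A ∷ R ∷ C ∷ z ∷ []) →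
           1 ⊛ A ≼ 12 ⊗ R ⊕ 2 ⊗ z , 12 ⊛ R ≼ C , 2 ⊛ z ≼ id , none ⊢ A ≼ 12 ⊗ C })
      (idle-dominated s₀ epochTimes epochTimes-sorted
          (All.map (λ 0≤t t≤-1 → 0≰-1 (≤-trans 0≤t t≤-1)) epochTimes-nonNegative) .cost≤
          execution (timedServices-sorted σ (Linked⇒AllPairs ≤-trans nondecreasing)) (λ ())
        ∷ residual≤cost θ execution ∷ d-refl s₀ ∷ [])
    where
    open Feasible feasible
    -- Any time strictly before all arrivals would do; 0 fails, as requests may arrive then. Both
    -- servers start at `s₀`, so the initial potential vanishes.
    θ  = - 1#
    vs = timedServices I σ

  -- The infimum need not be attained, so one twelfth of `ALG s₀`, obtained from division in the
  -- field, is shown to be a lower bound for all feasible costs and compared with the greatest one.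
  ALG≤12OPT : ∀ s₀ OPT → IsOPT I s₀ OPT → ALG s₀ ≤ 12 · OPT
  ALG≤12OPT s₀ OPT isOPT =
    ≤-trans (≤-reflexive (sym 12b≈ALG)) (·-monoʳ-≤ 12 (IsOPT.greatest isOPT b b≤cost))
    where
    b       = proj₁ (·-divisible 11 (ALG s₀))
    12b≈ALG = proj₂ (·-divisible 11 (ALG s₀))
    b≤cost : ∀ σ → Feasible I s₀ σ → b ≤ cost I σ
    b≤cost σ feasible =
      ·-cancelˡ-≤ 11 (≤-trans (≤-reflexive 12b≈ALG) (ALG≤12cost s₀ σ feasible))

theorem6p2 :
  ∀ {c ℓ₁ ℓ₂} (K : OrderedField c ℓ₁ ℓ₂) (M : FiniteMetricSpace K) →
  let open OrderedField K
      open FiniteMetricSpace M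
      open Online K M
  in (s₀ : Point) (I : Input) (oracle : SteinerOracle) (rule : FarthestRule I) →
     let open Algorithm I oracle rule
     in (∀ σ → Feasible I s₀ σ → ALG s₀ ≤ 12 · cost I σ) ×
        (∀ OPT → IsOPT I s₀ OPT → ALG s₀ ≤ 12 · OPT)
theorem6p2 K M s₀ I oracle rule = ALG≤12cost s₀ , ALG≤12OPT s₀
  where open CompetitiveAnalysis K M I oracle rule
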